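{- Let $r$ be a positive integer and let $s=(2r,3r,\ldots,nr)$ and $\mu=(r,2r,\ldots,nr)$. Then the ordered pair $(d_{n-1}^s,d_n^\mu)$ is the $\mathcal{I}_n$-decomposition of the colored derangement polynomial $d_{n,r}(z)$.
   Context: For a polynomial $p(z)$ of degree at most $d$, its $\mathcal{I}_d$-decomposition is the unique pair $(a,b)$ with $p(z)=a(z)+zb(z)$, $\deg a\le d$, $\deg b\le d-1$, $a(z)=z^da(1/z)$, $b(z)=z^{d-1}b(1/z)$. For a sequence $t=(t_1,\ldots,t_m)$ of positive integers, $P_m^t=\{x\in\mathbb{R}^m:0\le x_1/t_1\le\cdots\le x_m/t_m\le1\}$ and $d_m^t(z)=\ell^\ast(P_m^t;z)$, where for a lattice $d$-simplex $\Delta=\mathrm{conv}(v^{(0)},\ldots,v^{(d)})\subset\mathbb{R}^m$, $\ell^\ast(\Delta;z)=\sum_{x\in\Pi^\circ_\Delta\cap\mathbb{Z}^{m+1}}z^{x_{m+1}}$, $\Pi^\circ_\Delta=\{\sum_i\lambda_i(v^{(i)},1):0<\lambda_i<1\}$. An $r$-colored permutation is $(\pi,c)$ with $\pi\in\mathfrak{S}_n$, $c\in\{0,\ldots,r-1\}^n$; $i$ is an excedance if $\pi_i>i$ or ($\pi_i=i$ and $c_i>0$); derangements are those with no fixed point of color $0$; $d_{n,r}(z)=\sum z^{\mathrm{exc}(\sigma)}$ over all $r$-colored derangements of length $n$.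
   Formalization: With p=a+zb the literal pair fails (n=1, r=2: d_{1,2}=z, d_0^s=0, d_1^μ=z); what is proved is that d_n^μ=z·b and (d_{n-1}^s, b) is the I_n-decomposition, i.e. d_{n,r}=d_{n-1}^s+d_n^μ, for n≥1. Points of polytopes are taken rational, which gives the same polynomials. -}

module Defs where

open import Data.Nat.Base as ℕ using (ℕ; zero; suc; NonZero)
import Data.Nat.Properties as ℕ
open import Data.Integer.Base as ℤ using (ℤ; +_; 0ℤ; 1ℤ)
import Data.Integer.Properties as ℤ
open import Data.Rational.Base as ℚ using (ℚ; 0ℚ; 1ℚ; _/_)
open import Data.Rational.Properties using (+-0-commutativeMonoid)
open import Algebra.Properties.CommutativeMonoid.Sum +-0-commutativeMonoid
  using (sum)
open import Data.Fin.Base as Fin using (Fin; toℕ)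
import Data.Fin.Properties as Fin
open import Data.List.Base
  using (List; [_]; length; filter; allFin; cartesianProduct; cartesianProductWith)
open import Data.List.Membership.Propositional using (_∈_)
open import Data.List.Relation.Unary.Unique.Propositional using (Unique)
open import Data.Product.Base using (∃-syntax; _×_; _,_; proj₁; proj₂)
open import Data.Sum.Base using (_⊎_)
open import Data.Vec.Base using (Vec; []; _∷_; _∷ʳ_; lookup; last)
import Data.Vec.Relation.Unary.AllPairs as AllPairs
open import Function.Bundles using (_⇔_)
open import Level using (0ℓ)
open import Relation.Binary.PropositionalEquality.Core using (_≡_; _≗_)
open import Relation.Nullary using (¬_)
open import Relation.Nullary.Decidable using (¬?; _×-dec_; _⊎-dec_)
open import Relation.Unary using (Pred; Decidable; _≐_)

-- Polynomials are given by their coefficient sequences; the finiteness of the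
-- support is supplied by the degree bounds or the finite sums below.

Poly : Set
Poly = ℕ → ℤ

z·_ : Poly → Poly
(z· p) zero    = 0ℤ
(z· p) (suc k) = p k

-- Bounds are strict ("deg p < e") so that "deg b ≤ d - 1" also makes sense
-- for d = 0, where it means b = 0.
Degree<_ : ℕ → Pred Poly 0ℓ
(Degree< e) p = ∀ k → e ℕ.≤ k → p k ≡ 0ℤ

-- For p with deg p < e, this is p(z) = z^(e-1) p(1/z).
Palindromic : ℕ → Pred Poly 0ℓ
Palindromic e p = ∀ i j → suc (i ℕ.+ j) ≡ e → p i ≡ p j

record Splits (d : ℕ) (p a b : Poly) : Set where
  field
    sum-≡ : ∀ k → p k ≡ a k ℤ.+ (z· b) k
    deg-a : (Degree< suc d) a
    deg-b : (Degree< d) b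
    pal-a : Palindromic (suc d) a
    pal-b : Palindromic d b

record IsIDecomposition (d : ℕ) (p a b : Poly) : Set where
  field
    splits : Splits d p a b
    unique : ∀ a′ b′ → Splits d p a′ b′ → (a′ ≗ a) × (b′ ≗ b)

-- Coefficients of ∑ z^(w x), x running over the list.  Only exponents that
-- are natural numbers are recorded; all weights used below are nonnegative
-- (the last coordinate of a point of Π° is a sum of positive numbers).
gf : {A : Set} → (A → ℤ) → List A → Poly
gf w xs k = + length (filter (λ x → w x ℤ.≟ + k) xs)

record IsGF {A : Set} (S : Pred A 0ℓ) (w : A → ℤ) (p : Poly) : Set where
  field
    elements : List A
    distinct : Unique elements
    complete : ∀ x → x ∈ elements ⇔ S x
    coeffs   : p ≗ gf w elements

-- Real points are replaced by rational ones throughout.  For a simplex with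
-- lattice vertices this does not affect the lattice points of Π°: the vectors
-- (v⁽ⁱ⁾,1) are linearly independent over ℚ, so the coefficients expressing an
-- integer vector in terms of them are rational.

Point : ℕ → Set
Point m = Fin m → ℚ

ι : ∀ {m} → Vec ℤ m → Point m
ι x j = lookup x j / 1

combination : ∀ {k m} → (Fin k → ℚ) → (Fin k → Vec ℤ m) → Point m
combination c v j = sum (λ i → c i ℚ.* ι (v i) j)

AffinelyIndependent : ∀ {k m} → Pred (Fin k → Vec ℤ m) 0ℓ
AffinelyIndependent v = ∀ c → sum c ≡ 0ℚ → (∀ j → combination c v j ≡ 0ℚ) →
                        ∀ i → c i ≡ 0ℚ

conv : ∀ {k m} → (Fin k → Vec ℤ m) → Pred (Point m) 0ℓ
conv v x = ∃[ c ] (∀ i → 0ℚ ℚ.≤ c i) × sum c ≡ 1ℚ × combination c v ≗ x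

Π° : ∀ {k m} → (Fin k → Vec ℤ m) → Pred (Point (suc m)) 0ℓ
Π° v x = ∃[ c ] (∀ i → 0ℚ ℚ.< c i × c i ℚ.< 1ℚ) ×
                combination c (λ i → v i ∷ʳ 1ℤ) ≗ x

-- p is ℓ*(Δ; z).  The vertices of Δ are determined by Δ up to order, so p is too.
record Isℓ* {m : ℕ} (Δ : Pred (Point m) 0ℓ) (p : Poly) : Set where
  field
    dim         : ℕ
    vertices    : Fin (suc dim) → Vec ℤ m
    independent : AffinelyIndependent vertices
    hull        : Δ ≐ conv vertices
    isGF        : IsGF (λ x → Π° vertices (ι x)) last p

record PositiveSeq (m : ℕ) : Set where
  field
    term    : Fin m → ℕ
    nonZero : ∀ i → NonZero (term i)

-- The chain 0 ≤ x₁/t₁ ≤ ⋯ ≤ xₘ/tₘ ≤ 1, as its transitive closure.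
lectureHall : ∀ {m} → PositiveSeq m → Pred (Point m) 0ℓ
lectureHall t x =
    (∀ i → 0ℚ ℚ.≤ ratio i)
  × (∀ i j → i Fin.≤ j → ratio i ℚ.≤ ratio j)
  × (∀ i → ratio i ℚ.≤ 1ℚ)
  where
  open PositiveSeq t
  ratio : Fin _ → ℚ
  ratio i = x i ℚ.* _/_ (+ 1) (term i) {{nonZero i}}

-- p is d_m^t.
IsLectureHallℓ* : ∀ {m} → PositiveSeq m → Pred Poly 0ℓ
IsLectureHallℓ* t = Isℓ* (lectureHall t)

s-seq : ∀ n r .{{_ : NonZero r}} → PositiveSeq (ℕ.pred n)
s-seq n r = record
  { term    = λ i → (2 ℕ.+ toℕ i) ℕ.* r
  ; nonZero = λ i → ℕ.m*n≢0 (2 ℕ.+ toℕ i) r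
  }

μ-seq : ∀ n r .{{_ : NonZero r}} → PositiveSeq n
μ-seq n r = record
  { term    = λ i → (1 ℕ.+ toℕ i) ℕ.* r
  ; nonZero = λ i → ℕ.m*n≢0 (1 ℕ.+ toℕ i) r
  }

words : ∀ k n → List (Vec (Fin k) n)
words k zero    = [ [] ]
words k (suc n) = cartesianProductWith _∷_ (allFin k) (words k n)

permutations : ∀ n → List (Vec (Fin n) n)
permutations n = filter (AllPairs.allPairs? (λ i j → ¬? (i Fin.≟ j))) (words n n)

ColoredWord : ℕ → ℕ → Set
ColoredWord n r = Vec (Fin n) n × Vec (Fin r) n

coloredPermutations : ∀ n r → List (ColoredWord n r)
coloredPermutations n r = cartesianProduct (permutations n) (words r n)

module _ {n r : ℕ} (σ : ColoredWord n r) where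
  private
    π = lookup (proj₁ σ)
    c = lookup (proj₂ σ)

  Excedance : Pred (Fin n) 0ℓ
  Excedance i = i Fin.< π i ⊎ (π i ≡ i × 0 ℕ.< toℕ (c i))

  excedance? : Decidable Excedance
  excedance? i = (i Fin.<? π i) ⊎-dec ((π i Fin.≟ i) ×-dec (0 ℕ.<? toℕ (c i)))

  exc : ℕ
  exc = length (filter excedance? (allFin n))

  Derangement : Set
  Derangement = ∀ i → ¬ (π i ≡ i × toℕ (c i) ≡ 0)

derangement? : ∀ {n r} → Decidable (Derangement {n} {r})
derangement? (π , c) =
  Fin.all? λ i → ¬? ((lookup π i Fin.≟ i) ×-dec (toℕ (lookup c i) ℕ.≟ 0))

derangementPoly : ℕ → ℕ → Poly
derangementPoly n r =
  gf (λ σ → + exc σ) (filter derangement? (coloredPermutations n r))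

{-# OPTIONS --safe #-}
module Submission where

-- The lattice points (x₁, …, xₘ, h) of Π° for the simplex of t are the sequences with
-- 0 < xⱼ₊₁ / tⱼ₊₁ - xⱼ / tⱼ < 1 for 0 ≤ j ≤ m, where x₀ = 0, tₘ₊₁ = 1 and xₘ₊₁ = h.
-- The sequences for s are those for μ in which x₁ = 0, a value that μ forbids; so dˢ + dᵘ
-- counts the sequences for μ with x₁ ∈ {0, …, r - 1} unrestricted.  Collect those that end in
-- xⱼ = j (a + r k) + i, where 0 ≤ a < r and 0 ≤ i < j, into a series in z^k.  Up to a correction
-- at i = 0, increasing i by one adds (1 - z) times the series of the level below.
--
-- On the other side, the colored derangement polynomial is the permanent of the matrix with r z
-- above, r below and (r - 1) z on the diagonal.  Such a permanent is affine in each diagonal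
-- entry, with the smaller permanent as slope, so raising the diagonal entries one after the
-- other by 1 - z reproduces the recurrence in i.  After r rounds the diagonal entry
-- (r - 1) z has become r - z, and moving the last row to the top compares the two ends; since
-- only 0 is fixed by multiplication by z, this pins down the series.
--
-- The reflection xⱼ ↦ j tⱼ - xⱼ gives the palindromicity of both polynomials.

open import Defs
open import Algebra.Bundles using (AbelianGroup; CommutativeRing)
import Algebra.Construct.Pointwise as Pointwise
open import Data.Bool.Base using (Bool; true; false; not; _∧_; _∨_; if_then_else_)
open import Data.Fin.Base as Fin using (Fin; zero; suc; toℕ; punchIn; fromℕ<)
import Data.Fin.Properties as Fin
open import Data.Integer.Base as ℤ using (ℤ; 0ℤ; 1ℤ)
import Data.Integer.Properties as ℤ
open import Data.List.Base as List
  using (List; []; _∷_; _++_; length; replicate; filter; concatMap; downFrom; allFin; tabulate; cartesianProductWith)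
open import Data.List.Membership.Propositional using (_∈_; find; lose)
open import Data.List.Membership.Propositional.Properties
import Data.List.Properties as List
open import Data.List.Relation.Unary.All as All using (All; []; _∷_)
import Data.List.Relation.Unary.All.Properties as All
import Data.List.Relation.Unary.AllPairs as ListAllPairs
open ListAllPairs using ([]; _∷_)
import Data.List.Relation.Unary.AllPairs.Properties as ListAllPairs
open import Data.List.Relation.Unary.Any using (here; there)
open import Data.List.Relation.Unary.Unique.Propositional using (Unique)
import Data.List.Relation.Unary.Unique.Propositional.Properties as Unique
open import Data.Nat.Base as ℕ using (ℕ; zero; suc; NonZero)
import Data.Nat.Coprimality as Coprimality
import Data.Nat.Properties as ℕ
import Data.Nat.Tactic.RingSolver as ℕ-Solver
open import Data.Product.Base using (∃-syntax; _×_; _,_; proj₁; proj₂)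
import Data.Rational.Unnormalised.Base as ℚᵘ
import Data.Rational.Unnormalised.Properties as ℚᵘ
open import Data.Sum.Base using (inj₁; inj₂)
open import Data.Vec.Base as Vec using (Vec; []; _∷_; _∷ʳ_; lookup; last; initLast)
import Data.Vec.Properties as Vec
import Data.Vec.Relation.Unary.All as VecAll
import Data.Vec.Relation.Unary.AllPairs as AllPairs
open import Function.Base using (_∘_; id; const)
open import Function.Bundles using (_⇔_; mk⇔; Equivalence)
open import Level using (0ℓ; _⊔_)
open import Relation.Binary.Definitions using (tri<; tri≈; tri>)
open import Relation.Binary.PropositionalEquality as ≡ using (_≡_; _≢_; _≗_)
open import Relation.Nullary using (¬_)
open import Relation.Nullary.Decidable using (Dec; does; yes; no; ¬?; _×-dec_; dec-true; dec-false; does-⇔)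
open import Relation.Unary using (Decidable; _≐_)

-- Two points shape the argument. A height `h` is the same as the value `(n + 1) r h` in one further
-- coordinate with term `(n + 1) r`, which continues both sequences. So both polynomials are read
-- off at the same arguments, the case `a = i = 0`, although the induction needs all `a` and `i`.
-- The recurrence expresses the next level through partial sums of the current one. Their increments
-- match the changes of a permanent, but the value at which summation starts is unknown, so the
-- comparison holds only up to a defect independent of `a`. To show that the defect vanishes, the
-- ends `a = 0` and `a = r` have to be related on the permanent side too. This is why one diagonal
-- entry carries an additional `z`: it accounts for the correction at `i = 0`, and at the two ends
-- it turns `(r - 1) z` into `r z` and `r - z` into `r`, which are the off-diagonal entries, so that
-- a rotation of the rows applies.

-- The ring of integer power series.

module PowerSeries where

  open import Data.Integer.Base using (_+_; _*_)
  open import Data.Integer.Tactic.RingSolver using (solve-∀)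
  open ≡

  constant : ℤ → Poly
  constant a zero    = a
  constant a (suc _) = 0ℤ

  infixl 7 _⊛_

  _⊛_ : Poly → Poly → Poly
  (p ⊛ q) zero    = p 0 * q 0
  (p ⊛ q) (suc k) = p 0 * q (suc k) + ((p ∘ suc) ⊛ q) k

  ⊛-cong : ∀ {p p′ q q′} → p ≗ p′ → q ≗ q′ → p ⊛ q ≗ p′ ⊛ q′
  ⊛-cong e f zero    = cong₂ _*_ (e 0) (f 0)
  ⊛-cong e f (suc k) = cong₂ _+_ (cong₂ _*_ (e 0) (f (suc k))) (⊛-cong (e ∘ suc) f k)

  ⊛-zeroˡ : ∀ q k → ((λ _ → 0ℤ) ⊛ q) k ≡ 0ℤ
  ⊛-zeroˡ q zero    = refl
  ⊛-zeroˡ q (suc k) = trans (ℤ.+-identityˡ _) (⊛-zeroˡ q k)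

  ⊛-constantˡ : ∀ a q k → (constant a ⊛ q) k ≡ a * q k
  ⊛-constantˡ a q zero    = refl
  ⊛-constantˡ a q (suc k) = trans (cong ((a * q (suc k)) +_) (⊛-zeroˡ q k)) (ℤ.+-identityʳ _)

  ⊛-identityˡ : ∀ q k → (constant 1ℤ ⊛ q) k ≡ q k
  ⊛-identityˡ q k = trans (⊛-constantˡ 1ℤ q k) (ℤ.*-identityˡ (q k))

  ⊛-distribʳ : ∀ q p p′ k → ((λ i → p i + p′ i) ⊛ q) k ≡ (p ⊛ q) k + (p′ ⊛ q) k
  ⊛-distribʳ q p p′ zero    = ℤ.*-distribʳ-+ (q 0) (p 0) (p′ 0)
  ⊛-distribʳ q p p′ (suc k) = trans
    (cong (((p 0 + p′ 0) * q (suc k)) +_) (⊛-distribʳ q (p ∘ suc) (p′ ∘ suc) k))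
    (rearranged (p 0) (p′ 0) (q (suc k)) _ _)
    where
    rearranged : ∀ a b c x y → (a + b) * c + (x + y) ≡ a * c + x + (b * c + y)
    rearranged = solve-∀

  ⊛-scaleˡ : ∀ a p q k → ((λ i → a * p i) ⊛ q) k ≡ a * (p ⊛ q) k
  ⊛-scaleˡ a p q zero    = ℤ.*-assoc a (p 0) (q 0)
  ⊛-scaleˡ a p q (suc k) = trans
    (cong ((a * p 0 * q (suc k)) +_) (⊛-scaleˡ a (p ∘ suc) q k))
    (rearranged a (p 0) (q (suc k)) _)
    where
    rearranged : ∀ a b c x → a * b * c + a * x ≡ a * (b * c + x)
    rearranged = solve-∀

  ⊛-tailʳ : ∀ p q k → (p ⊛ q) (suc k) ≡ (p ⊛ (q ∘ suc)) k + p (suc k) * q 0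
  ⊛-tailʳ p q zero    = refl
  ⊛-tailʳ p q (suc k) = trans
    (cong ((p 0 * q (suc (suc k))) +_) (⊛-tailʳ (p ∘ suc) q k))
    (sym (ℤ.+-assoc (p 0 * q (suc (suc k))) _ _))

  ⊛-comm : ∀ p q → p ⊛ q ≗ q ⊛ p
  ⊛-comm p q zero    = ℤ.*-comm (p 0) (q 0)
  ⊛-comm p q (suc k) = begin
    p 0 * q (suc k) + ((p ∘ suc) ⊛ q) k ≡⟨ cong₂ _+_ (ℤ.*-comm (p 0) _) (⊛-comm (p ∘ suc) q k) ⟩
    q (suc k) * p 0 + (q ⊛ (p ∘ suc)) k ≡⟨ ℤ.+-comm (q (suc k) * p 0) _ ⟩
    (q ⊛ (p ∘ suc)) k + q (suc k) * p 0 ≡⟨ ⊛-tailʳ q p k ⟨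
    (q ⊛ p) (suc k)                         ∎
    where open ≡-Reasoning

  ⊛-assoc : ∀ p q s → (p ⊛ q) ⊛ s ≗ p ⊛ (q ⊛ s)
  ⊛-assoc p q s zero    = ℤ.*-assoc (p 0) (q 0) (s 0)
  ⊛-assoc p q s (suc k) = begin
    p 0 * q 0 * s (suc k) + ((λ i → p 0 * q (suc i) + ((p ∘ suc) ⊛ q) i) ⊛ s) k
      ≡⟨ cong ((p 0 * q 0 * s (suc k)) +_) (trans
           (⊛-distribʳ s (λ i → p 0 * q (suc i)) ((p ∘ suc) ⊛ q) k)
           (cong₂ _+_ (⊛-scaleˡ (p 0) (q ∘ suc) s k) (⊛-assoc (p ∘ suc) q s k))) ⟩
    p 0 * q 0 * s (suc k) + (p 0 * ((q ∘ suc) ⊛ s) k + ((p ∘ suc) ⊛ (q ⊛ s)) k)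
      ≡⟨ rearranged (p 0) (q 0) (s (suc k)) _ _ ⟩
    p 0 * (q 0 * s (suc k) + ((q ∘ suc) ⊛ s) k) + ((p ∘ suc) ⊛ (q ⊛ s)) k ∎
    where
    open ≡-Reasoning
    rearranged : ∀ a b c x y → a * b * c + (a * x + y) ≡ a * (b * c + x) + y
    rearranged = solve-∀

  commutativeRing : CommutativeRing 0ℓ 0ℓ
  commutativeRing = record
    { Carrier = Poly
    ; _≈_     = _≗_
    ; _+_     = λ p q k → p k + q k
    ; _*_     = _⊛_
    ; -_      = λ p k → ℤ.- p k
    ; 0#      = λ _ → 0ℤ
    ; 1#      = constant 1ℤ
    ; isCommutativeRing = record
      { isRing = record
        { +-isAbelianGroup = AbelianGroup.isAbelianGroup (Pointwise.abelianGroup ℕ ℤ.+-0-abelianGroup)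
        ; *-cong     = ⊛-cong
        ; *-assoc    = ⊛-assoc
        ; *-identity = ⊛-identityˡ , λ p k → trans (⊛-comm p (constant 1ℤ) k) (⊛-identityˡ p k)
        ; distrib    =
            (λ p q s k → trans (⊛-comm p _ k) (trans (⊛-distribʳ p q s k)
               (cong₂ _+_ (⊛-comm q p k) (⊛-comm s p k))))
          , ⊛-distribʳ
        }
      ; *-comm = ⊛-comm
      }
    }

  indeterminate : Poly
  indeterminate = z· (constant 1ℤ)

  indeterminate-⊛ : ∀ p → indeterminate ⊛ p ≗ z· p
  indeterminate-⊛ p zero    = refl
  indeterminate-⊛ p (suc k) = trans (ℤ.+-identityˡ _) (⊛-identityˡ p k)

-- Permanents: moving rows, changing a diagonal entry, rotating a constant row.

skip : ℕ → ℕ → ℕ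
skip zero    c       = suc c
skip (suc i) zero    = zero
skip (suc i) (suc c) = suc (skip i c)

toℕ-punchIn : ∀ {n} (i : Fin (suc n)) c → toℕ (punchIn i c) ≡ skip (toℕ i) (toℕ c)
toℕ-punchIn zero    c       = ≡.refl
toℕ-punchIn (suc i) zero    = ≡.refl
toℕ-punchIn (suc i) (suc c) = ≡.cong suc (toℕ-punchIn i c)

infixr 5 _◂_

_◂_ : ∀ {a} {A : Set a} → A → (ℕ → A) → ℕ → A
(x ◂ f) zero    = x
(x ◂ f) (suc i) = f i

module Permanents {a ℓ} (R : CommutativeRing a ℓ) where

  open CommutativeRing R hiding (zero)
  open import Algebra.Properties.Semiring.Sum semiring
  open import Relation.Binary.Reasoning.Setoid setoid
  open import Algebra.Properties.CommutativeSemigroup *-commutativeSemigroup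
    using (x∙yz≈y∙xz)
  open import Algebra.Properties.AbelianGroup +-abelianGroup using (∙-cancelʳ)

  Row : Set a
  Row = ℕ → Carrier

  kill : ℕ → Row → Row
  kill zero    ρ zero    = 0#
  kill zero    ρ (suc c) = ρ (suc c)
  kill (suc i) ρ zero    = ρ zero
  kill (suc i) ρ (suc c) = kill i (ρ ∘ suc) c

  kill-at : ∀ i ρ → kill i ρ i ≡ 0#
  kill-at zero    ρ = ≡.refl
  kill-at (suc i) ρ = kill-at i (ρ ∘ suc)

  kill-off : ∀ {i c} ρ → i ≢ c → kill i ρ c ≡ ρ c
  kill-off {zero}  {zero}  ρ i≢c with () ← i≢c ≡.refl
  kill-off {zero}  {suc c} ρ i≢c = ≡.refl
  kill-off {suc i} {zero}  ρ i≢c = ≡.refl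
  kill-off {suc i} {suc c} ρ i≢c = kill-off (ρ ∘ suc) (i≢c ∘ ≡.cong suc)

  kill-comm : ∀ i j ρ c → kill i (kill j ρ) c ≡ kill j (kill i ρ) c
  kill-comm zero    zero    ρ c       = ≡.refl
  kill-comm zero    (suc j) ρ zero    = ≡.refl
  kill-comm zero    (suc j) ρ (suc c) = ≡.refl
  kill-comm (suc i) zero    ρ zero    = ≡.refl
  kill-comm (suc i) zero    ρ (suc c) = ≡.refl
  kill-comm (suc i) (suc j) ρ zero    = ≡.refl
  kill-comm (suc i) (suc j) ρ (suc c) = kill-comm i j (ρ ∘ suc) c

  kill-skip : ∀ i j ρ c → kill (skip i j) ρ (skip i c) ≡ kill j (ρ ∘ skip i) c
  kill-skip zero    zero    ρ zero    = ≡.refl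
  kill-skip zero    zero    ρ (suc c) = ≡.refl
  kill-skip zero    (suc j) ρ zero    = ≡.refl
  kill-skip zero    (suc j) ρ (suc c) = kill-skip zero j (ρ ∘ suc) c
  kill-skip (suc i) zero    ρ zero    = ≡.refl
  kill-skip (suc i) zero    ρ (suc c) = ≡.refl
  kill-skip (suc i) (suc j) ρ zero    = ≡.refl
  kill-skip (suc i) (suc j) ρ (suc c) = kill-skip i j (ρ ∘ suc) c

  kill-cong : ∀ {k} i {ρ σ : Row} → (∀ c → c ℕ.< k → ρ c ≈ σ c) → ∀ c → c ℕ.< k → kill i ρ c ≈ kill i σ c
  kill-cong zero    e zero    _   = refl
  kill-cong zero    e (suc c) c<k = e (suc c) c<k
  kill-cong (suc i) e zero    c<k = e zero c<k
  kill-cong {suc k} (suc i) e (suc c) c<k =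
    kill-cong {k} i (λ d d<k → e (suc d) (ℕ.s<s d<k)) c (ℕ.s<s⁻¹ c<k)

  kill-zero : ∀ i j {ρ : Row} → ρ j ≈ 0# → kill i ρ j ≈ 0#
  kill-zero i j {ρ} e with i ℕ.≟ j
  ... | yes ≡.refl = reflexive (kill-at i ρ)
  ... | no i≢j     = trans (reflexive (kill-off ρ i≢j)) e

  -- The permanent of the first n rows and k columns; a used column is set to zero.
  perm : ℕ → ℕ → (ℕ → Row) → Carrier
  perm k zero    ρ = 1#
  perm k (suc n) ρ = ∑[ c < k ] (ρ 0 (toℕ c) * perm k n (λ i → kill (toℕ c) (ρ (suc i))))

  perm-cong : ∀ k n (ρ σ : ℕ → Row) → (∀ i c → i ℕ.< n → c ℕ.< k → ρ i c ≈ σ i c) →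
              perm k n ρ ≈ perm k n σ
  perm-cong k zero    ρ σ e = refl
  perm-cong k (suc n) ρ σ e = sum-cong-≋ λ c →
    *-cong (e 0 (toℕ c) ℕ.z<s (Fin.toℕ<n c))
           (perm-cong k n _ _ λ i d i<n d<k →
             kill-cong (toℕ c) (λ d → e (suc i) d (ℕ.s<s i<n)) d d<k)

  perm-cong′ : ∀ k n (ρ σ : ℕ → Row) → (∀ i c → ρ i c ≡ σ i c) → perm k n ρ ≈ perm k n σ
  perm-cong′ k n ρ σ e = perm-cong k n ρ σ (λ i c _ _ → reflexive (e i c))

  -- Expanding along both rows gives a double sum over pairs of columns. Pairs of equal columns
  -- vanish because the second row is zeroed there; in the others the two factors commute and the
  -- order of zeroing is irrelevant.
  perm-swap : ∀ k n ρ σ τ → perm k (suc (suc n)) (ρ ◂ σ ◂ τ) ≈ perm k (suc (suc n)) (σ ◂ ρ ◂ τ)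
  perm-swap k n ρ σ τ = begin
    ∑[ c < k ] (ρ (toℕ c) * ∑[ d < k ] term σ c d)
      ≈⟨ sum-cong-≋ (λ c → *-distribˡ-sum (ρ (toℕ c)) (term σ c)) ⟩
    ∑[ c < k ] ∑[ d < k ] (ρ (toℕ c) * term σ c d)
      ≈⟨ sum-cong-≋ (λ c → sum-cong-≋ (λ d → symmetric c d)) ⟩
    ∑[ c < k ] ∑[ d < k ] (σ (toℕ d) * term ρ d c)
      ≈⟨ ∑-comm (λ c d → σ (toℕ d) * term ρ d c) ⟩
    ∑[ d < k ] ∑[ c < k ] (σ (toℕ d) * term ρ d c)
      ≈⟨ sum-cong-≋ (λ d → *-distribˡ-sum (σ (toℕ d)) (term ρ d)) ⟨
    ∑[ d < k ] (σ (toℕ d) * ∑[ c < k ] term ρ d c) ∎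
    where
    rest : Fin k → Fin k → Carrier
    rest c d = perm k n (λ i → kill (toℕ d) (kill (toℕ c) (τ i)))
    term : Row → Fin k → Fin k → Carrier
    term υ c d = kill (toℕ c) υ (toℕ d) * rest c d
    vanishing : ∀ x y {z} → y ≡ 0# → x * (y * z) ≈ 0#
    vanishing x y ≡.refl = trans (*-congˡ (zeroˡ _)) (zeroʳ x)
    symmetric : ∀ c d → ρ (toℕ c) * term σ c d ≈ σ (toℕ d) * term ρ d c
    symmetric c d with toℕ c ℕ.≟ toℕ d
    ... | yes c≡d = trans
      (vanishing _ _ (≡.subst (λ e → kill (toℕ c) σ e ≡ 0#) c≡d (kill-at (toℕ c) σ)))
      (sym (vanishing _ _ (≡.subst (λ e → kill (toℕ d) ρ e ≡ 0#) (≡.sym c≡d) (kill-at (toℕ d) ρ))))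
    ... | no c≢d rewrite kill-off σ c≢d | kill-off ρ (c≢d ∘ ≡.sym) = trans
      (*-congˡ (*-congˡ (perm-cong′ k n _ _ (λ i e → kill-comm (toℕ d) (toℕ c) (τ i) e))))
      (x∙yz≈y∙xz _ _ _)

  perm-move : ∀ k n i ρ → i ℕ.≤ n → perm k (suc n) ρ ≈ perm k (suc n) (ρ i ◂ ρ ∘ skip i)
  perm-move k n       zero    ρ i≤n = perm-cong′ k (suc n) ρ (ρ 0 ◂ ρ ∘ suc) λ { zero _ → ≡.refl ; (suc _) _ → ≡.refl }
  perm-move k (suc n) (suc i) ρ i≤n = begin
    ∑[ c < k ] (ρ 0 (toℕ c) * perm k (suc n) (λ j → kill (toℕ c) (ρ (suc j))))
      ≈⟨ sum-cong-≋ {k} (λ c → *-congˡ (perm-move k n i (λ j → kill (toℕ c) (ρ (suc j))) (ℕ.s≤s⁻¹ i≤n))) ⟩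
    perm k (suc (suc n)) (ρ 0 ◂ ρ (suc i) ◂ ρ ∘ suc ∘ skip i)
      ≈⟨ perm-swap k n (ρ 0) (ρ (suc i)) (ρ ∘ suc ∘ skip i) ⟩
    perm k (suc (suc n)) (ρ (suc i) ◂ ρ 0 ◂ ρ ∘ suc ∘ skip i)
      ≈⟨ perm-cong′ k (suc (suc n)) (ρ (suc i) ◂ ρ 0 ◂ ρ ∘ suc ∘ skip i) (ρ (suc i) ◂ ρ ∘ skip (suc i)) (λ { zero _ → ≡.refl ; (suc zero) _ → ≡.refl ; (suc (suc _)) _ → ≡.refl }) ⟩
    perm k (suc (suc n)) (ρ (suc i) ◂ ρ ∘ skip (suc i)) ∎

  perm-+ : ∀ k n ρ σ τ → perm k (suc n) ((λ c → ρ c + σ c) ◂ τ) ≈ perm k (suc n) (ρ ◂ τ) + perm k (suc n) (σ ◂ τ)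
  perm-+ k n ρ σ τ = trans
    (sum-cong-≋ {k} (λ c → distribʳ _ (ρ (toℕ c)) (σ (toℕ c))))
    (∑-distrib-+ {k} _ _)

  perm-scale : ∀ k n x ρ τ → perm k (suc n) ((λ c → x * ρ c) ◂ τ) ≈ x * perm k (suc n) (ρ ◂ τ)
  perm-scale k n x ρ τ = trans
    (sum-cong-≋ {k} (λ c → *-assoc x (ρ (toℕ c)) _))
    (sym (*-distribˡ-sum {k} x _))

  -- Exchanges zeroing for true deletion: no term of the expansion can use the zero column. This
  -- identifies the remainder of an expansion as the permanent of a minor.
  perm-skip : ∀ k n (i : Fin (suc k)) ρ → (∀ j → ρ j (toℕ i) ≈ 0#) →
              perm (suc k) n ρ ≈ perm k n (λ j → ρ j ∘ skip (toℕ i))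
  perm-skip k zero    i ρ e = refl
  perm-skip k (suc n) i ρ e = begin
    perm (suc k) (suc n) ρ
      ≈⟨ sum-remove {k} {i} (λ c → ρ 0 (toℕ c) * rest (toℕ c)) ⟩
    ρ 0 (toℕ i) * rest (toℕ i) + ∑[ c < k ] (ρ 0 (toℕ (punchIn i c)) * rest (toℕ (punchIn i c)))
      ≈⟨ +-cong (trans (*-congʳ (e 0)) (zeroˡ _)) (sum-cong-≋ other) ⟩
    0# + perm k (suc n) (λ j → ρ j ∘ skip (toℕ i))
      ≈⟨ +-identityˡ _ ⟩
    perm k (suc n) (λ j → ρ j ∘ skip (toℕ i)) ∎
    where
    rest : ℕ → Carrier
    rest c = perm (suc k) n (λ j → kill c (ρ (suc j)))
    other : ∀ c → ρ 0 (toℕ (punchIn i c)) * rest (toℕ (punchIn i c)) ≈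
                  ρ 0 (skip (toℕ i) (toℕ c)) * perm k n (λ j → kill (toℕ c) (ρ (suc j) ∘ skip (toℕ i)))
    other c rewrite toℕ-punchIn i c = *-congˡ (trans
      (perm-skip k n i _ (λ j → kill-zero (skip (toℕ i) (toℕ c)) (toℕ i) {ρ (suc j)} (e (suc j))))
      (perm-cong′ k n _ _ (λ j → kill-skip (toℕ i) (toℕ c) (ρ (suc j)))))

  unit : ℕ → Row
  unit zero    zero    = 1#
  unit zero    (suc _) = 0#
  unit (suc i) zero    = 0#
  unit (suc i) (suc c) = unit i c

  unit-at : ∀ i → unit i i ≡ 1#
  unit-at zero    = ≡.refl
  unit-at (suc i) = unit-at i

  unit-skip : ∀ i c → unit i (skip i c) ≡ 0#
  unit-skip zero    c       = ≡.refl
  unit-skip (suc i) zero    = ≡.refl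
  unit-skip (suc i) (suc c) = unit-skip i c

  skip≢ : ∀ i c → i ≢ skip i c
  skip≢ (suc i) (suc c) e = skip≢ i c (ℕ.suc-injective e)

  perm-unit : ∀ k n (i : Fin (suc k)) τ →
              perm (suc k) (suc n) (unit (toℕ i) ◂ τ) ≈ perm k n (λ j → τ j ∘ skip (toℕ i))
  perm-unit k n i τ = begin
    perm (suc k) (suc n) (unit (toℕ i) ◂ τ)
      ≈⟨ sum-remove {k} {i} (λ c → unit (toℕ i) (toℕ c) * rest (toℕ c)) ⟩
    unit (toℕ i) (toℕ i) * rest (toℕ i) + ∑[ c < k ] (unit (toℕ i) (toℕ (punchIn i c)) * rest (toℕ (punchIn i c)))
      ≈⟨ +-cong (trans (*-congʳ (reflexive (unit-at (toℕ i)))) (*-identityˡ _)) (sum-cong-≋ other) ⟩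
    rest (toℕ i) + ∑[ c < k ] 0#
      ≈⟨ trans (+-congˡ (sum-replicate-zero k)) (+-identityʳ _) ⟩
    rest (toℕ i)
      ≈⟨ perm-skip k n i _ (λ j → reflexive (kill-at (toℕ i) (τ j))) ⟩
    perm k n (λ j → kill (toℕ i) (τ j) ∘ skip (toℕ i))
      ≈⟨ perm-cong′ k n _ _ (λ j c → kill-off (τ j) (skip≢ (toℕ i) c)) ⟩
    perm k n (λ j → τ j ∘ skip (toℕ i)) ∎
    where
    rest : ℕ → Carrier
    rest c = perm (suc k) n (λ j → kill c (τ j))
    other : ∀ c → unit (toℕ i) (toℕ (punchIn i c)) * rest (toℕ (punchIn i c)) ≈ 0#
    other c rewrite toℕ-punchIn i c | unit-skip (toℕ i) (toℕ c) = zeroˡ _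

  module _ (p q : Carrier) where

    -- Diagonal xs, with p above and q below the diagonal.
    matrix : List Carrier → ℕ → Row
    matrix []       = λ _ _ → 0#
    matrix (x ∷ xs) = (x ◂ const p) ◂ λ i → q ◂ matrix xs i

    D : List Carrier → Carrier
    D xs = perm (length xs) (length xs) (matrix xs)

    matrix-row : ∀ xs ys {x y d} → y ≈ x + d → ∀ c →
      matrix (xs ++ y ∷ ys) (length xs) c ≈ matrix (xs ++ x ∷ ys) (length xs) c + d * unit (length xs) c
    matrix-row []       ys e zero    = trans e (+-congˡ (sym (*-identityʳ _)))
    matrix-row []       ys e (suc c) = sym (trans (+-congˡ (zeroʳ _)) (+-identityʳ p))
    matrix-row (_ ∷ xs) ys e zero    = sym (trans (+-congˡ (zeroʳ _)) (+-identityʳ q))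
    matrix-row (_ ∷ xs) ys e (suc c) = matrix-row xs ys e c

    matrix-other-row : ∀ xs ys x y i c →
      matrix (xs ++ y ∷ ys) (skip (length xs) i) c ≡ matrix (xs ++ x ∷ ys) (skip (length xs) i) c
    matrix-other-row []       ys x y i       c       = ≡.refl
    matrix-other-row (_ ∷ xs) ys x y zero    c       = ≡.refl
    matrix-other-row (_ ∷ xs) ys x y (suc i) zero    = ≡.refl
    matrix-other-row (_ ∷ xs) ys x y (suc i) (suc c) = matrix-other-row xs ys x y i c

    matrix-minor : ∀ xs ys x i c →
      matrix (xs ++ x ∷ ys) (skip (length xs) i) (skip (length xs) c) ≡ matrix (xs ++ ys) i c
    matrix-minor []       ys x i       c       = ≡.refl
    matrix-minor (_ ∷ xs) ys x zero    zero    = ≡.refl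
    matrix-minor (_ ∷ xs) ys x zero    (suc c) = ≡.refl
    matrix-minor (_ ∷ xs) ys x (suc i) zero    = ≡.refl
    matrix-minor (_ ∷ xs) ys x (suc i) (suc c) = matrix-minor xs ys x i c

    length-insert : ∀ xs (x : Carrier) ys → length (xs ++ x ∷ ys) ≡ suc (length (xs ++ ys))
    length-insert []       x ys = ≡.refl
    length-insert (_ ∷ xs) x ys = ≡.cong suc (length-insert xs x ys)

    -- Once moved to the top, the row of the changed entry differs by `d` times a unit vector. The
    -- permanent is linear in that row, and the unit vector leaves the minor without this row and
    -- column, which is again a matrix of the same shape.
    D-shift : ∀ xs ys {x y d} → y ≈ x + d → D (xs ++ y ∷ ys) ≈ D (xs ++ x ∷ ys) + d * D (xs ++ ys)
    D-shift xs ys {x} {y} {d} y≈x+d = begin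
      D (xs ++ y ∷ ys)
        ≈⟨ expand y ⟩
      perm (suc n) (suc n) (matrix (xs ++ y ∷ ys) i ◂ matrix (xs ++ y ∷ ys) ∘ skip i)
        ≈⟨ perm-cong (suc n) (suc n) (matrix (xs ++ y ∷ ys) i ◂ matrix (xs ++ y ∷ ys) ∘ skip i)
             ((λ c → matrix (xs ++ x ∷ ys) i c + d * unit i c) ◂ others) (λ
             { zero    c _ _ → matrix-row xs ys y≈x+d c
             ; (suc j) c _ _ → reflexive (matrix-other-row xs ys x y j c) }) ⟩
      perm (suc n) (suc n) ((λ c → matrix (xs ++ x ∷ ys) i c + d * unit i c) ◂ others)
        ≈⟨ perm-+ (suc n) n (matrix (xs ++ x ∷ ys) i) (λ c → d * unit i c) others ⟩
      perm (suc n) (suc n) (matrix (xs ++ x ∷ ys) i ◂ others) + perm (suc n) (suc n) ((λ c → d * unit i c) ◂ others)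
        ≈⟨ +-cong (sym (expand x)) (trans (perm-scale (suc n) n d (unit i) others) (*-congˡ minor)) ⟩
      D (xs ++ x ∷ ys) + d * D (xs ++ ys) ∎
      where
      i = length xs
      n = length (xs ++ ys)
      others = matrix (xs ++ x ∷ ys) ∘ skip i
      i≤n : i ℕ.≤ n
      i≤n = ≡.subst (i ℕ.≤_) (≡.sym (List.length-++ xs)) (ℕ.m≤m+n _ _)
      expand : ∀ w → D (xs ++ w ∷ ys) ≈
        perm (suc n) (suc n) (matrix (xs ++ w ∷ ys) i ◂ matrix (xs ++ w ∷ ys) ∘ skip i)
      expand w = trans
        (reflexive (≡.cong (λ m → perm m m (matrix (xs ++ w ∷ ys))) (length-insert xs w ys)))
        (perm-move (suc n) n i (matrix (xs ++ w ∷ ys)) i≤n)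
      minor : perm (suc n) (suc n) (unit i ◂ others) ≈ D (xs ++ ys)
      minor with perm-unit n n (fromℕ< (ℕ.s≤s i≤n)) others
      ... | e rewrite Fin.toℕ-fromℕ< (ℕ.s≤s i≤n) = trans e (perm-cong′ n n _ _ (matrix-minor xs ys x))

    matrix-last-row : ∀ n c → c ℕ.≤ n → matrix (replicate (suc n) q) n c ≡ q
    matrix-last-row zero    zero    _   = ≡.refl
    matrix-last-row (suc n) zero    _   = ≡.refl
    matrix-last-row (suc n) (suc c) c≤n = matrix-last-row n c (ℕ.s≤s⁻¹ c≤n)

    matrix-shifted-row : ∀ n i c → i ℕ.< n →
      matrix (replicate (suc n) q) (skip n i) c ≡ (q ◂ matrix (replicate n p) i) c
    matrix-shifted-row (suc n) zero    zero          _   = ≡.refl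
    matrix-shifted-row (suc n) zero    (suc zero)    _   = ≡.refl
    matrix-shifted-row (suc n) zero    (suc (suc c)) _   = ≡.refl
    matrix-shifted-row (suc n) (suc i) zero          _   = ≡.refl
    matrix-shifted-row (suc n) (suc i) (suc c)       i<n = matrix-shifted-row n i c (ℕ.s<s⁻¹ i<n)

    -- Moving the constant last row to the top turns q on the diagonal into p.
    D-rotate : ∀ {z} → p ≈ z * q → ∀ n → D (replicate (suc n) p) ≈ z * D (replicate (suc n) q)
    D-rotate {z} p≈zq n rewrite List.length-replicate n {p} | List.length-replicate n {q} = sym (begin
      z * perm (suc n) (suc n) (matrix (replicate (suc n) q))
        ≈⟨ *-congˡ (perm-move (suc n) n n (matrix (replicate (suc n) q)) ℕ.≤-refl) ⟩
      z * perm (suc n) (suc n) (matrix (replicate (suc n) q) n ◂ matrix (replicate (suc n) q) ∘ skip n)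
        ≈⟨ *-congˡ (perm-cong (suc n) (suc n) (matrix (replicate (suc n) q) n ◂ matrix (replicate (suc n) q) ∘ skip n)
             (const q ◂ lower) (λ
             { zero    c _   c<n → reflexive (matrix-last-row n c (ℕ.s≤s⁻¹ c<n))
             ; (suc i) c i<n _   → reflexive (matrix-shifted-row n i c (ℕ.s<s⁻¹ i<n)) })) ⟩
      z * perm (suc n) (suc n) (const q ◂ lower)
        ≈⟨ perm-scale (suc n) n z (const q) lower ⟨
      perm (suc n) (suc n) ((λ _ → z * q) ◂ lower)
        ≈⟨ perm-cong (suc n) (suc n) ((λ _ → z * q) ◂ lower) (matrix (replicate (suc n) p)) (λ
             { zero    zero    _ _ → sym p≈zq
             ; zero    (suc c) _ _ → sym p≈zq
             ; (suc i) c       _ _ → refl }) ⟩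
      perm (suc n) (suc n) (matrix (replicate (suc n) p)) ∎)
      where
      lower : ℕ → Row
      lower i = q ◂ matrix (replicate n p) i

    replicate-∷ : ∀ n (x : Carrier) ys → replicate n x ++ x ∷ ys ≡ x ∷ replicate n x ++ ys
    replicate-∷ zero    x ys = ≡.refl
    replicate-∷ (suc n) x ys = ≡.cong (x ∷_) (replicate-∷ n x ys)

    -- Raising one of the `m` lowered entries by `z` changes each side by `z` times an instance of
    -- smaller size, so `D-rotate` descends by induction on `m`. The head stays unlowered: there
    -- must be a row to rotate, as the claim fails for the empty matrix.
    D-rotate-lowered : ∀ {z v w} → p ≈ z * q → p ≈ w + z → q ≈ v + z → ∀ m n →
      D (p ∷ replicate m w ++ replicate n p) ≈ z * D (q ∷ replicate m v ++ replicate n q)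
    D-rotate-lowered p≈zq p≈w+z q≈v+z zero    n = D-rotate p≈zq n
    D-rotate-lowered {z} {v} {w} p≈zq p≈w+z q≈v+z (suc m) n = ∙-cancelʳ _ _ _ (begin
      D (p ∷ w ∷ replicate m w ++ replicate n p) + z * D (p ∷ replicate m w ++ replicate n p)
        ≡⟨ ≡.cong (λ xs → D (p ∷ xs) + z * D (p ∷ replicate m w ++ replicate n p)) (replicate-∷ m w (replicate n p)) ⟨
      D ((p ∷ replicate m w) ++ w ∷ replicate n p) + z * D (p ∷ replicate m w ++ replicate n p)
        ≈⟨ D-shift (p ∷ replicate m w) (replicate n p) p≈w+z ⟨
      D (p ∷ replicate m w ++ replicate (suc n) p)
        ≈⟨ D-rotate-lowered p≈zq p≈w+z q≈v+z m (suc n) ⟩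
      z * D (q ∷ replicate m v ++ replicate (suc n) q)
        ≈⟨ *-congˡ (D-shift (q ∷ replicate m v) (replicate n q) q≈v+z) ⟩
      z * (D ((q ∷ replicate m v) ++ v ∷ replicate n q) + z * D (q ∷ replicate m v ++ replicate n q))
        ≈⟨ distribˡ z _ _ ⟩
      z * D ((q ∷ replicate m v) ++ v ∷ replicate n q) + z * (z * D (q ∷ replicate m v ++ replicate n q))
        ≈⟨ +-cong (reflexive (≡.cong (λ xs → z * D (q ∷ xs)) (replicate-∷ m v (replicate n q))))
                  (*-congˡ (sym (D-rotate-lowered p≈zq p≈w+z q≈v+z m n))) ⟩
      z * D (q ∷ v ∷ replicate m v ++ replicate n q) + z * D (p ∷ replicate m w ++ replicate n p) ∎)

-- The recurrence of the counting series and its solution by permanents.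

module Recurrence {a ℓ} (R : CommutativeRing a ℓ) where

  open CommutativeRing R hiding (zero)
  open Permanents R
  open import Relation.Binary.Reasoning.Setoid setoid
  open import Algebra.Properties.AbelianGroup +-abelianGroup using (∙-cancelʳ)
  open import Algebra.Properties.CommutativeSemigroup +-commutativeSemigroup
    using (xy∙z≈xz∙y)

  -- `u` stands for `1 - z` and `α a` for the diagonal entry after `a` rounds. `α-first` and
  -- `α-last` are the hypotheses of `D-rotate-lowered` with `w = α 0` and `v = α r`.
  record Parameters (r : ℕ) : Set (a ⊔ ℓ) where
    field
      p q z u    : Carrier
      α          : ℕ → Carrier
      p≈zq       : p ≈ z * q
      u+z≈1      : u + z ≈ 1#
      u-cancel   : ∀ {x y} → u * x ≈ u * y → x ≈ y
      α-suc      : ∀ a → α (suc a) ≈ α a + u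
      α-first    : p ≈ α 0 + z
      α-last     : q ≈ α r + z

  module _ {r : ℕ} (parameters : Parameters r) where
    open Parameters parameters

    -- F n a i is the series of the values of a function Φ at (n + 1) (a + r k) + i, and C n a i
    -- that of the sums of Φ over the smaller arguments, so (1 - z) C counts a window.
    record Satisfies (F C : ℕ → ℕ → ℕ → Carrier) : Set ℓ where
      field
        F-start  : ∀ {a} → a ℕ.< r → F 0 a 0 ≈ 1#
        F-zero   : ∀ n {a} → a ℕ.< r → F (suc n) a 0 + z * F n a 0 ≈ u * C n a 0
        F-suc    : ∀ n {a} i → a ℕ.< r → i ℕ.≤ n → F (suc n) a (suc i) ≈ u * C n a (suc i)
        C-suc    : ∀ n a i → i ℕ.≤ n → C n a (suc i) ≈ C n a i + F n a i
        C-wrap   : ∀ n a → C n a (suc n) ≈ C n (suc a) 0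
        C-period : ∀ n → C n 0 0 ≈ z * C n r 0

    -- The diagonal during round `a`: the head and `i` further entries have been raised, `l` entries
    -- still wait. The head has the additional `z` throughout.
    mixed : ℕ → ℕ → ℕ → Carrier
    mixed a i l = D p q ((α (suc a) + z) ∷ replicate i (α (suc a)) ++ replicate l (α a))

    pure : ℕ → ℕ → Carrier
    pure a n = D p q ((α a + z) ∷ replicate n (α a))

    pure-period : ∀ n → pure 0 n ≈ z * pure r n
    pure-period n = begin
      pure 0 n
        ≈⟨ head-cong 0 n (sym α-first) ⟩
      D p q (p ∷ replicate n (α 0))
        ≡⟨ ≡.cong (λ xs → D p q (p ∷ xs)) (List.++-identityʳ (replicate n (α 0))) ⟨
      D p q (p ∷ replicate n (α 0) ++ [])
        ≈⟨ D-rotate-lowered p q p≈zq α-first α-last n 0 ⟩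
      z * D p q (q ∷ replicate n (α r) ++ [])
        ≡⟨ ≡.cong (λ xs → z * D p q (q ∷ xs)) (List.++-identityʳ (replicate n (α r))) ⟩
      z * D p q (q ∷ replicate n (α r))
        ≈⟨ *-congˡ (head-cong r n α-last) ⟩
      z * pure r n ∎
      where
      head-cong : ∀ a n {x y} → x ≈ y → D p q (x ∷ replicate n (α a)) ≈ D p q (y ∷ replicate n (α a))
      head-cong a n {x} {y} x≈y = trans
        (D-shift p q [] (replicate n (α a)) {y} {x} {0#} (trans x≈y (sym (+-identityʳ y))))
        (trans (+-congˡ (zeroˡ _)) (+-identityʳ _))

    mixed-zero : ∀ a n → mixed a 0 n ≈ pure a n + u * D p q (replicate n (α a))
    mixed-zero a n = D-shift p q [] (replicate n (α a))
      (trans (+-congʳ (α-suc a)) (xy∙z≈xz∙y (α a) u z))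

    mixed-suc : ∀ a i l → mixed a (suc i) l ≈ mixed a i (suc l) + u * mixed a i l
    mixed-suc a i l = begin
      D p q ((α (suc a) + z) ∷ α (suc a) ∷ replicate i (α (suc a)) ++ replicate l (α a))
        ≡⟨ ≡.cong (λ xs → D p q ((α (suc a) + z) ∷ xs)) (replicate-∷ p q i (α (suc a)) (replicate l (α a))) ⟨
      D p q (((α (suc a) + z) ∷ replicate i (α (suc a))) ++ α (suc a) ∷ replicate l (α a))
        ≈⟨ D-shift p q ((α (suc a) + z) ∷ replicate i (α (suc a))) (replicate l (α a)) (α-suc a) ⟩
      mixed a i (suc l) + u * mixed a i l ∎

    mixed-full : ∀ a n → mixed a n 0 ≈ pure (suc a) n
    mixed-full a n = reflexive (≡.cong (λ xs → D p q ((α (suc a) + z) ∷ xs))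
      (List.++-identityʳ (replicate n (α (suc a)))))

    module _ {F C : ℕ → ℕ → ℕ → Carrier} (satisfies : Satisfies F C) where
      open Satisfies satisfies

      -- The remainder of the argument is the number of raised diagonal entries. At remainder 0 the
      -- head lacks its `z`, in keeping with the additional term of `F-zero`.
      record Agrees (n : ℕ) : Set ℓ where
        field
          at-zero : ∀ {a} → a ℕ.< r → F n a 0 ≈ D p q (replicate n (α a))
          at-suc  : ∀ {a} i l → a ℕ.< r → suc i ℕ.+ l ≡ n → F n a (suc i) ≈ mixed a i l

      module _ {n : ℕ} (level : Agrees n) where
        open Agrees level

        -- A telescoping sum: `C n a (suc i)` exceeds `C n a 0` by `F n a 0`, ..., `F n a i`, and
        -- `u` times each of these is the change of the permanent of size `n + 1` when one more
        -- entry is raised by `u`. Negative terms are moved to the other side.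
        C-mixed : ∀ {a} → a ℕ.< r → ∀ i l → i ℕ.+ l ≡ n →
                  u * C n a (suc i) + pure a n ≈ u * C n a 0 + mixed a i l
        C-mixed {a} a<r zero l ≡.refl = begin
          u * C n a 1 + pure a n
            ≈⟨ +-congʳ (trans (*-congˡ (C-suc n a 0 ℕ.z≤n)) (distribˡ u _ _)) ⟩
          u * C n a 0 + u * F n a 0 + pure a n
            ≈⟨ trans (+-assoc _ _ _) (+-congˡ (+-comm _ _)) ⟩
          u * C n a 0 + (pure a n + u * F n a 0)
            ≈⟨ +-congˡ (trans (+-congˡ (*-congˡ (at-zero a<r))) (sym (mixed-zero a n))) ⟩
          u * C n a 0 + mixed a 0 n ∎
        C-mixed {a} a<r (suc i) l i+l≡n = begin
          u * C n a (suc (suc i)) + pure a n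
            ≈⟨ +-congʳ (trans (*-congˡ (C-suc n a (suc i) i<n)) (distribˡ u _ _)) ⟩
          u * C n a (suc i) + u * F n a (suc i) + pure a n
            ≈⟨ xy∙z≈xz∙y _ _ _ ⟩
          u * C n a (suc i) + pure a n + u * F n a (suc i)
            ≈⟨ +-cong (C-mixed a<r i (suc l) (≡.trans (ℕ.+-suc i l) i+l≡n)) (*-congˡ (at-suc i l a<r i+l≡n)) ⟩
          u * C n a 0 + mixed a i (suc l) + u * mixed a i l
            ≈⟨ trans (+-assoc _ _ _) (+-congˡ (sym (mixed-suc a i l))) ⟩
          u * C n a 0 + mixed a (suc i) l ∎
          where
          i<n : suc i ℕ.≤ n
          i<n = ≡.subst (suc i ℕ.≤_) i+l≡n (ℕ.m≤m+n (suc i) l)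

        -- The defect `u * C n a 0 - pure a n` does not depend on `a`: a complete round changes both
        -- terms equally, by `C-mixed` with all entries raised.
        C-constant-defect : ∀ a → a ℕ.≤ r → u * C n a 0 + pure 0 n ≈ u * C n 0 0 + pure a n
        C-constant-defect zero    _   = refl
        C-constant-defect (suc a) a<r = ∙-cancelʳ (pure a n) _ _ (begin
          u * C n (suc a) 0 + pure 0 n + pure a n
            ≈⟨ xy∙z≈xz∙y _ _ _ ⟩
          u * C n (suc a) 0 + pure a n + pure 0 n
            ≈⟨ +-congʳ (+-congʳ (*-congˡ (C-wrap n a))) ⟨
          u * C n a (suc n) + pure a n + pure 0 n
            ≈⟨ +-congʳ (trans (C-mixed a<r n 0 (ℕ.+-identityʳ n)) (+-congˡ (mixed-full a n))) ⟩
          u * C n a 0 + pure (suc a) n + pure 0 n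
            ≈⟨ xy∙z≈xz∙y _ _ _ ⟩
          u * C n a 0 + pure 0 n + pure (suc a) n
            ≈⟨ +-congʳ (C-constant-defect a (ℕ.<⇒≤ a<r)) ⟩
          u * C n 0 0 + pure a n + pure (suc a) n
            ≈⟨ xy∙z≈xz∙y _ _ _ ⟩
          u * C n 0 0 + pure (suc a) n + pure a n ∎)

        -- Passing from a = r to a = 0 multiplies the defect by z, so the defect is 0.
        C-first : u * C n 0 0 ≈ pure 0 n
        C-first = u-cancel (∙-cancelʳ (z * x + z * y) _ _ (begin
          u * x + (z * x + z * y)   ≈⟨ split x y ⟩
          x + z * y                 ≈⟨ x+zy≈zx+y ⟩
          z * x + y                 ≈⟨ +-comm _ _ ⟩
          y + z * x                 ≈⟨ split y x ⟨
          u * y + (z * y + z * x)   ≈⟨ +-congˡ (+-comm _ _) ⟩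
          u * y + (z * x + z * y)   ∎))
          where
          x = u * C n 0 0
          y = pure 0 n
          split : ∀ x y → u * x + (z * x + z * y) ≈ x + z * y
          split x y = trans (sym (+-assoc _ _ _))
            (+-congʳ (trans (sym (distribʳ x u z)) (trans (*-congʳ u+z≈1) (*-identityˡ x))))
          period : z * (u * C n r 0) ≈ x
          period = trans (sym (*-assoc z u _)) (trans (*-congʳ (*-comm z u))
            (trans (*-assoc u z _) (*-congˡ (sym (C-period n)))))
          x+zy≈zx+y : x + z * y ≈ z * x + y
          x+zy≈zx+y = begin
            x + z * y                      ≈⟨ +-congʳ period ⟨
            z * (u * C n r 0) + z * y      ≈⟨ distribˡ z _ _ ⟨
            z * (u * C n r 0 + y)          ≈⟨ *-congˡ (C-constant-defect r ℕ.≤-refl) ⟩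
            z * (x + pure r n)             ≈⟨ distribˡ z _ _ ⟩
            z * x + z * pure r n           ≈⟨ +-congˡ (pure-period n) ⟨
            z * x + y                      ∎

        C-pure : ∀ a → a ℕ.≤ r → u * C n a 0 ≈ pure a n
        C-pure a a≤r = ∙-cancelʳ (pure 0 n) _ _
          (trans (C-constant-defect a a≤r) (trans (+-congʳ C-first) (+-comm _ _)))

        next : Agrees (suc n)
        next = record
          { at-zero = λ {a} a<r → ∙-cancelʳ (z * D p q (replicate n (α a))) _ _ (begin
              F (suc n) a 0 + z * D p q (replicate n (α a))
                ≈⟨ +-congˡ (*-congˡ (at-zero a<r)) ⟨
              F (suc n) a 0 + z * F n a 0
                ≈⟨ F-zero n a<r ⟩
              u * C n a 0
                ≈⟨ C-pure a (ℕ.<⇒≤ a<r) ⟩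
              pure a n
                -- Splitting the `z` off the head produces exactly the correction term of `F-zero`,
                -- which then cancels.
                ≈⟨ D-shift p q [] (replicate n (α a)) refl ⟩
              D p q (replicate (suc n) (α a)) + z * D p q (replicate n (α a)) ∎)
          ; at-suc = λ {a} i l a<r i+l≡n → trans
              (F-suc n i a<r (≡.subst (i ℕ.≤_) (ℕ.suc-injective i+l≡n) (ℕ.m≤m+n i l)))
              (∙-cancelʳ (pure a n) _ _ (trans
                (C-mixed a<r i l (ℕ.suc-injective i+l≡n))
                (trans (+-congʳ (C-pure a (ℕ.<⇒≤ a<r))) (+-comm _ _))))
          }

      level : ∀ n → Agrees n
      level zero    = record { at-zero = F-start ; at-suc = λ _ _ _ () }
      level (suc n) = next (level n)

      F-permanent : ∀ n {a} → a ℕ.< r → F n a 0 ≈ D p q (replicate n (α a))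
      F-permanent n = Agrees.at-zero (level n)

-- The generating function of colored derangements as a permanent.

module WordSums {a ℓ} (R : CommutativeRing a ℓ) where

  open CommutativeRing R hiding (zero)
  open Permanents R
  open import Algebra.Properties.Semiring.Sum semiring
  open import Algebra.Properties.CommutativeMonoid.Sum *-commutativeMonoid
    using () renaming (sum to product; sum-cong-≋ to product-cong; ∑-distrib-+ to product-*)
  open import Algebra.Properties.Semiring.Exp semiring using (_^_)
  open import Algebra.Properties.Semiring.Mult semiring using (×-comm-*; ×-congʳ) renaming (_×_ to _·_)
  open import Relation.Binary.Reasoning.Setoid setoid
  open import Algebra.Properties.CommutativeSemigroup *-commutativeSemigroup
    using (x∙yz≈y∙xz; interchange)

  private variable
    A B : Set

  ∑ˡ : (A → Carrier) → List A → Carrier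
  ∑ˡ f []       = 0#
  ∑ˡ f (x ∷ xs) = f x + ∑ˡ f xs

  ∑ˡ-cong : ∀ {f g : A → Carrier} → (∀ x → f x ≈ g x) → ∀ xs → ∑ˡ f xs ≈ ∑ˡ g xs
  ∑ˡ-cong e []       = refl
  ∑ˡ-cong e (x ∷ xs) = +-cong (e x) (∑ˡ-cong e xs)

  ∑ˡ-++ : ∀ (f : A → Carrier) xs ys → ∑ˡ f (xs ++ ys) ≈ ∑ˡ f xs + ∑ˡ f ys
  ∑ˡ-++ f []       ys = sym (+-identityˡ _)
  ∑ˡ-++ f (x ∷ xs) ys = trans (+-congˡ (∑ˡ-++ f xs ys)) (sym (+-assoc _ _ _))

  ∑ˡ-map : ∀ (f : B → Carrier) (g : A → B) xs → ∑ˡ f (List.map g xs) ≡ ∑ˡ (f ∘ g) xs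
  ∑ˡ-map f g []       = ≡.refl
  ∑ˡ-map f g (x ∷ xs) = ≡.cong (f (g x) +_) (∑ˡ-map f g xs)

  ∑ˡ-* : ∀ y (f : A → Carrier) xs → ∑ˡ (λ x → y * f x) xs ≈ y * ∑ˡ f xs
  ∑ˡ-* y f []       = sym (zeroʳ y)
  ∑ˡ-* y f (x ∷ xs) = trans (+-congˡ (∑ˡ-* y f xs)) (sym (distribˡ y _ _))

  ∑ˡ-cartesianProductWith : ∀ {C : Set} (g : C → Carrier) (f : A → B → C) xs ys →
    ∑ˡ g (cartesianProductWith f xs ys) ≈ ∑ˡ (λ x → ∑ˡ (λ y → g (f x y)) ys) xs
  ∑ˡ-cartesianProductWith g f []       ys = refl
  ∑ˡ-cartesianProductWith g f (x ∷ xs) ys = trans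
    (∑ˡ-++ g (List.map (f x) ys) _)
    (+-cong (reflexive (∑ˡ-map g (f x) ys)) (∑ˡ-cartesianProductWith g f xs ys))

  ∑ˡ-tabulate : ∀ {n} (g : A → Carrier) (f : Fin n → A) → ∑ˡ g (tabulate f) ≡ sum (g ∘ f)
  ∑ˡ-tabulate {n = zero}  g f = ≡.refl
  ∑ˡ-tabulate {n = suc n} g f = ≡.cong (g (f zero) +_) (∑ˡ-tabulate g (f ∘ suc))

  𝟙 : Bool → Carrier
  𝟙 true  = 1#
  𝟙 false = 0#

  𝟙-∧ : ∀ a b → 𝟙 (a ∧ b) ≈ 𝟙 a * 𝟙 b
  𝟙-∧ true  b = sym (*-identityˡ _)
  𝟙-∧ false b = sym (zeroˡ _)

  ∑ˡ-filter : ∀ {P : A → Set} (P? : Decidable P) f xs →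
              ∑ˡ f (filter P? xs) ≈ ∑ˡ (λ x → 𝟙 (does (P? x)) * f x) xs
  ∑ˡ-filter P? f [] = refl
  ∑ˡ-filter P? f (x ∷ xs) with does (P? x)
  ... | true  = +-cong (sym (*-identityˡ _)) (∑ˡ-filter P? f xs)
  ... | false = trans (sym (+-identityˡ _)) (+-cong (sym (zeroˡ _)) (∑ˡ-filter P? f xs))

  -- Stated for an arbitrary decision of the universal claim, as all such decisions have the same
  -- truth value.
  𝟙-all : ∀ {n} {P : Fin n → Set} (P? : Decidable P) (all : Dec (∀ i → P i)) →
          𝟙 (does all) ≈ product (λ i → 𝟙 (does (P? i)))
  𝟙-all {zero}  P? all with all
  ... | yes _  = refl
  ... | no ¬p with () ← ¬p (λ ())
  𝟙-all {suc n} {P} P? all = trans (reflexive (≡.cong 𝟙 (agree (P? zero) rest)))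
    (trans (𝟙-∧ (does (P? zero)) (does rest)) (*-congˡ (𝟙-all (P? ∘ suc) rest)))
    where
    rest : Dec (∀ i → P (suc i))
    rest = Fin.all? (P? ∘ suc)
    agree : (p0? : Dec (P zero)) (ps? : Dec (∀ i → P (suc i))) → does all ≡ does p0? ∧ does ps?
    agree (yes p0) (yes ps) = dec-true all λ { zero → p0 ; (suc i) → ps i }
    agree (yes p0) (no ¬ps) = dec-false all (λ ps → ¬ps (ps ∘ suc))
    agree (no ¬p0) _        = dec-false all (λ ps → ¬p0 (ps zero))

  ^-length-filter : ∀ {n} {P : A → Set} (P? : Decidable P) z (f : Fin n → A) →
    z ^ length (filter P? (tabulate f)) ≈ product (λ i → if does (P? (f i)) then z else 1#)
  ^-length-filter {n = zero}  P? z f = refl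
  ^-length-filter {n = suc n} P? z f with does (P? (f zero))
  ... | true  = *-congˡ (^-length-filter P? z (f ∘ suc))
  ... | false = trans (^-length-filter P? z (f ∘ suc)) (sym (*-identityˡ _))

  -- Distributivity: a word picks one summand from each factor. For a fixed permutation it lets the
  -- colors at different positions be summed independently.
  ∑ˡ-words : ∀ k n (ρ : Fin n → Fin k → Carrier) →
    ∑ˡ (λ w → product (λ i → ρ i (lookup w i))) (words k n) ≈ product (λ i → sum (ρ i))
  ∑ˡ-words k zero    ρ = +-identityʳ 1#
  ∑ˡ-words k (suc n) ρ = begin
    ∑ˡ (λ w → product (λ i → ρ i (lookup w i))) (words k (suc n))
      ≈⟨ ∑ˡ-cartesianProductWith _ _∷_ (allFin k) (words k n) ⟩
    ∑ˡ (λ c → ∑ˡ (λ w → ρ zero c * product (λ i → ρ (suc i) (lookup w i))) (words k n)) (allFin k)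
      ≈⟨ ∑ˡ-cong (λ c → trans (∑ˡ-* (ρ zero c) _ (words k n))
                          (*-congˡ (∑ˡ-words k n (ρ ∘ suc)))) (allFin k) ⟩
    ∑ˡ (λ c → ρ zero c * product (λ i → sum (ρ (suc i)))) (allFin k)
      ≡⟨ ∑ˡ-tabulate {n = k} _ id ⟩
    sum (λ c → ρ zero c * product (λ i → sum (ρ (suc i))))
      ≈⟨ *-distribʳ-sum _ (ρ zero) ⟨
    sum (ρ zero) * product (λ i → sum (ρ (suc i))) ∎

  weightOf : ∀ {k n} → (ℕ → Row) → Vec (Fin k) n → Carrier
  weightOf ρ w = product (λ i → ρ (toℕ i) (toℕ (lookup w i)))

  distinct? : ∀ {k n} → Decidable (AllPairs.AllPairs {A = Fin k} _≢_ {n})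
  distinct? = AllPairs.allPairs? (λ i j → ¬? (i Fin.≟ j))

  -- Avoiding the letter `c` is a condition on each position separately, so its indicator can be
  -- absorbed into the weights as a zero column.
  weightOf-kill : ∀ {k n} (c : Fin k) ρ (w : Vec (Fin k) n) →
    𝟙 (does (VecAll.all? (λ d → ¬? (c Fin.≟ d)) w)) * weightOf ρ w ≈ weightOf (λ i → kill (toℕ c) (ρ i)) w
  weightOf-kill c ρ []      = *-identityˡ _
  weightOf-kill c ρ (d ∷ w) = begin
    𝟙 (not (does (c Fin.≟ d)) ∧ does (VecAll.all? (λ d → ¬? (c Fin.≟ d)) w)) * (ρ 0 (toℕ d) * weightOf (ρ ∘ suc) w)
      ≈⟨ *-congʳ (𝟙-∧ (not (does (c Fin.≟ d))) _) ⟩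
    𝟙 (not (does (c Fin.≟ d))) * 𝟙 (does (VecAll.all? (λ d → ¬? (c Fin.≟ d)) w)) * (ρ 0 (toℕ d) * weightOf (ρ ∘ suc) w)
      ≈⟨ interchange _ _ _ _ ⟩
    𝟙 (not (does (c Fin.≟ d))) * ρ 0 (toℕ d) * (𝟙 (does (VecAll.all? (λ d → ¬? (c Fin.≟ d)) w)) * weightOf (ρ ∘ suc) w)
      ≈⟨ *-cong (killed (ρ 0)) (weightOf-kill c (ρ ∘ suc) w) ⟩
    weightOf (λ i → kill (toℕ c) (ρ i)) (d ∷ w) ∎
    where
    killed : ∀ τ → 𝟙 (not (does (c Fin.≟ d))) * τ (toℕ d) ≈ kill (toℕ c) τ (toℕ d)
    killed τ with c Fin.≟ d
    ... | yes ≡.refl = trans (zeroˡ _) (reflexive (≡.sym (kill-at (toℕ c) τ)))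
    ... | no c≢d     = trans (*-identityˡ _) (reflexive (≡.sym (kill-off τ (c≢d ∘ Fin.toℕ-injective))))

  ∑ˡ-distinct-words : ∀ k n ρ →
    ∑ˡ (λ w → 𝟙 (does (distinct? w)) * weightOf ρ w) (words k n) ≈ perm k n ρ
  ∑ˡ-distinct-words k zero    ρ = trans (+-identityʳ _) (*-identityˡ _)
  ∑ˡ-distinct-words k (suc n) ρ = begin
    ∑ˡ (λ w → 𝟙 (does (distinct? w)) * weightOf ρ w) (words k (suc n))
      ≈⟨ ∑ˡ-cartesianProductWith _ _∷_ (allFin k) (words k n) ⟩
    ∑ˡ (λ c → ∑ˡ (λ w → 𝟙 (does (distinct? (c ∷ w))) * (ρ 0 (toℕ c) * weightOf (ρ ∘ suc) w)) (words k n)) (allFin k)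
      ≈⟨ ∑ˡ-cong (λ c → ∑ˡ-cong (λ w → first c w) (words k n)) (allFin k) ⟩
    ∑ˡ (λ c → ∑ˡ (λ w → ρ 0 (toℕ c) * (𝟙 (does (distinct? w)) * weightOf (λ i → kill (toℕ c) (ρ (suc i))) w)) (words k n)) (allFin k)
      ≈⟨ ∑ˡ-cong (λ c → trans (∑ˡ-* (ρ 0 (toℕ c)) _ (words k n))
                          (*-congˡ (∑ˡ-distinct-words k n (λ i → kill (toℕ c) (ρ (suc i)))))) (allFin k) ⟩
    ∑ˡ (λ c → ρ 0 (toℕ c) * perm k n (λ i → kill (toℕ c) (ρ (suc i)))) (allFin k)
      ≡⟨ ∑ˡ-tabulate {n = k} _ id ⟩
    perm k (suc n) ρ ∎
    where
    first : ∀ c w → 𝟙 (does (distinct? (c ∷ w))) * (ρ 0 (toℕ c) * weightOf (ρ ∘ suc) w) ≈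
                    ρ 0 (toℕ c) * (𝟙 (does (distinct? w)) * weightOf (λ i → kill (toℕ c) (ρ (suc i))) w)
    first c w = begin
      𝟙 (does c∉w ∧ does (distinct? w)) * (ρ 0 (toℕ c) * weightOf (ρ ∘ suc) w)
        ≈⟨ x∙yz≈y∙xz _ _ _ ⟩
      ρ 0 (toℕ c) * (𝟙 (does c∉w ∧ does (distinct? w)) * weightOf (ρ ∘ suc) w)
        ≈⟨ *-congˡ (*-congʳ (trans (𝟙-∧ (does c∉w) _) (*-comm _ _))) ⟩
      ρ 0 (toℕ c) * (𝟙 (does (distinct? w)) * 𝟙 (does c∉w) * weightOf (ρ ∘ suc) w)
        ≈⟨ *-congˡ (trans (*-assoc _ _ _) (*-congˡ (weightOf-kill c (ρ ∘ suc) w))) ⟩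
      ρ 0 (toℕ c) * (𝟙 (does (distinct? w)) * weightOf (λ i → kill (toℕ c) (ρ (suc i))) w) ∎
      where c∉w = VecAll.all? (λ d → ¬? (c Fin.≟ d)) w

  module _ (p q x : Carrier) where

    matrix-above : ∀ n i c → i ℕ.< n → i ℕ.< c → matrix p q (replicate n x) i c ≡ p
    matrix-above (suc n) zero    (suc c) _   _   = ≡.refl
    matrix-above (suc n) (suc i) (suc c) i<n i<c = matrix-above n i c (ℕ.s<s⁻¹ i<n) (ℕ.s<s⁻¹ i<c)

    matrix-diagonal : ∀ n i → i ℕ.< n → matrix p q (replicate n x) i i ≡ x
    matrix-diagonal (suc n) zero    _   = ≡.refl
    matrix-diagonal (suc n) (suc i) i<n = matrix-diagonal n i (ℕ.s<s⁻¹ i<n)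

    matrix-below : ∀ n i c → i ℕ.< n → c ℕ.< i → matrix p q (replicate n x) i c ≡ q
    matrix-below (suc n) (suc i) zero    _   _   = ≡.refl
    matrix-below (suc n) (suc i) (suc c) i<n c<i = matrix-below n i c (ℕ.s<s⁻¹ i<n) (ℕ.s<s⁻¹ c<i)

  module _ (z : Carrier) (r : ℕ) where

    -- The contribution of the value j with color c at position i.
    entry : ∀ {n} → Fin n → Fin n → Fin (suc r) → Carrier
    entry i j c = 𝟙 (not (does (j Fin.≟ i) ∧ does (toℕ c ℕ.≟ 0))) *
      (if does (i Fin.<? j) ∨ (does (j Fin.≟ i) ∧ does (0 ℕ.<? toℕ c)) then z else 1#)

    above below diagonal : Carrier
    above    = z * (suc r · 1#)
    below    = suc r · 1#
    diagonal = r · z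

    -- Off the diagonal all `suc r` colors count alike, each with `z` above and 1 below. On the
    -- diagonal color 0 would be a forbidden fixed point, and the other `r` colors each make an
    -- excedance.
    ∑-entry : ∀ {n} (i j : Fin n) →
      sum (entry i j) ≈ matrix above below (replicate n diagonal) (toℕ i) (toℕ j)
    ∑-entry {n} i j with Fin.<-cmp i j
    ... | tri< i<j i≢j _
      rewrite matrix-above above below diagonal n (toℕ i) (toℕ j) (Fin.toℕ<n i) i<j
            | dec-true (i Fin.<? j) i<j | dec-false (j Fin.≟ i) (i≢j ∘ ≡.sym)
      = trans (sum-replicate (suc r)) (trans (×-congʳ (suc r) (*-comm 1# z)) (sym (×-comm-* (suc r) z 1#)))
    ... | tri≈ i≮i ≡.refl _
      rewrite matrix-diagonal above below diagonal n (toℕ i) (Fin.toℕ<n i)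
            | dec-false (i Fin.<? i) i≮i | dec-true (i Fin.≟ i) ≡.refl
      = trans (+-cong (zeroˡ _) (sum-replicate r)) (trans (+-identityˡ _) (×-congʳ r (*-identityˡ z)))
    ... | tri> i≮j i≢j j<i
      rewrite matrix-below above below diagonal n (toℕ i) (toℕ j) (Fin.toℕ<n i) j<i
            | dec-false (i Fin.<? j) i≮j | dec-false (j Fin.≟ i) (i≢j ∘ ≡.sym)
      = trans (sum-replicate (suc r)) (×-congʳ (suc r) (*-identityˡ 1#))

    ∑ˡ-derangements : ∀ n →
      ∑ˡ (λ σ → z ^ exc σ) (filter derangement? (coloredPermutations n (suc r))) ≈
      D above below (replicate n diagonal)
    ∑ˡ-derangements n = begin
      ∑ˡ (λ σ → z ^ exc σ) (filter derangement? (coloredPermutations n (suc r)))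
        ≈⟨ ∑ˡ-filter derangement? _ (coloredPermutations n (suc r)) ⟩
      ∑ˡ (λ σ → 𝟙 (does (derangement? σ)) * z ^ exc σ) (coloredPermutations n (suc r))
        ≈⟨ ∑ˡ-cong factor (coloredPermutations n (suc r)) ⟩
      ∑ˡ (λ (π , c) → product (λ i → entry i (lookup π i) (lookup c i))) (coloredPermutations n (suc r))
        ≈⟨ ∑ˡ-cartesianProductWith _ _,_ (permutations n) (words (suc r) n) ⟩
      ∑ˡ (λ π → ∑ˡ (λ c → product (λ i → entry i (lookup π i) (lookup c i))) (words (suc r) n)) (permutations n)
        ≈⟨ ∑ˡ-cong (λ π → trans (∑ˡ-words (suc r) n (λ i → entry i (lookup π i)))
                                (product-cong (λ i → ∑-entry i (lookup π i)))) (permutations n) ⟩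
      ∑ˡ (weightOf rows) (permutations n)
        ≈⟨ ∑ˡ-filter distinct? _ (words n n) ⟩
      ∑ˡ (λ w → 𝟙 (does (distinct? w)) * weightOf rows w) (words n n)
        ≈⟨ ∑ˡ-distinct-words n n rows ⟩
      perm n n rows
        ≡⟨ ≡.cong (λ m → perm m m rows) (List.length-replicate n) ⟨
      D above below (replicate n diagonal) ∎
      where
      rows = matrix above below (replicate n diagonal)
      -- Both being a derangement and the excedance count are decided position by position, so the
      -- weight is a product over the positions.
      factor : ∀ σ → 𝟙 (does (derangement? σ)) * z ^ exc σ ≈
                     product (λ i → entry i (lookup (proj₁ σ) i) (lookup (proj₂ σ) i))
      factor σ@(π , c) = trans
        (*-cong (𝟙-all (λ i → ¬? ((lookup π i Fin.≟ i) ×-dec (toℕ (lookup c i) ℕ.≟ 0))) (derangement? σ))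
                (^-length-filter (excedance? σ) z id))
        (sym (product-* {n} _ _))

-- Counting chains, and the reflection of chains.

module Counting where

  open import Data.Nat.Base using (_+_; _*_; _∸_; _≤_; _<_; z≤n; s≤s)
  open import Data.Nat.Properties
  open import Data.Nat.Tactic.RingSolver using (solve-∀)
  open ≡
  open ≡-Reasoning

  ∑< : ℕ → (ℕ → ℕ) → ℕ
  ∑< zero    f = 0
  ∑< (suc n) f = ∑< n f + f n

  ∑<-cong : ∀ n {f g : ℕ → ℕ} → (∀ x → x < n → f x ≡ g x) → ∑< n f ≡ ∑< n g
  ∑<-cong zero    e = refl
  ∑<-cong (suc n) e = cong₂ _+_ (∑<-cong n (λ x x<n → e x (m<n⇒m<1+n x<n))) (e n ≤-refl)

  ∑<-+ : ∀ n (f g : ℕ → ℕ) → ∑< n (λ x → f x + g x) ≡ ∑< n f + ∑< n g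
  ∑<-+ zero    f g = refl
  ∑<-+ (suc n) f g rewrite ∑<-+ n f g = interchanged (∑< n f) (∑< n g) (f n) (g n)
    where
    interchanged : ∀ a b c d → a + b + (c + d) ≡ a + c + (b + d)
    interchanged = solve-∀

  ∑<-extend : ∀ n d {f : ℕ → ℕ} → (∀ x → n ≤ x → f x ≡ 0) → ∑< (n + d) f ≡ ∑< n f
  ∑<-extend n zero    {f} e = cong (λ m → ∑< m f) (+-identityʳ n)
  ∑<-extend n (suc d) {f} e rewrite +-suc n d | e (n + d) (m≤m+n n d) | ∑<-extend n d {f} e = +-identityʳ _

  ∑<-head : ∀ n (f : ℕ → ℕ) → ∑< (suc n) f ≡ f 0 + ∑< n (f ∘ suc)
  ∑<-head zero    f = sym (+-identityʳ (f 0))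
  ∑<-head (suc n) f = trans (cong (_+ f (suc n)) (∑<-head n f)) (+-assoc (f 0) _ _)

  ∑<-reverse : ∀ n (f : ℕ → ℕ) → ∑< (suc n) f ≡ ∑< (suc n) (λ x → f (n ∸ x))
  ∑<-reverse zero    f = refl
  ∑<-reverse (suc n) f = begin
    ∑< (suc n) f + f (suc n)                         ≡⟨ cong (_+ f (suc n)) (∑<-reverse n f) ⟩
    ∑< (suc n) (λ x → f (n ∸ x)) + f (suc n)         ≡⟨ +-comm _ (f (suc n)) ⟩
    f (suc n) + ∑< (suc n) (λ x → f (n ∸ x))         ≡⟨ ∑<-head (suc n) (λ x → f (suc n ∸ x)) ⟨
    ∑< (suc (suc n)) (λ x → f (suc n ∸ x))           ∎

  χ : Bool → ℕ
  χ true  = 1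
  χ false = 0

  χ-true : ∀ {P : Set} (P? : Dec P) → P → χ (does P?) ≡ 1
  χ-true P? p = cong χ (dec-true P? p)

  χ-false : ∀ {P : Set} (P? : Dec P) → ¬ P → χ (does P?) ≡ 0
  χ-false P? ¬p = cong χ (dec-false P? ¬p)

  ∑<-restrict : ∀ m d (f : ℕ → ℕ) → ∑< (m + d) (λ x → χ (does (x <? m)) * f x) ≡ ∑< m f
  ∑<-restrict m d f = trans
    (∑<-extend m d (λ x m≤x → cong (_* f x) (χ-false (x <? m) (≤⇒≯ m≤x))))
    (∑<-cong m (λ x x<m → trans (cong (_* f x) (χ-true (x <? m) x<m)) (*-identityˡ (f x))))

  -- The indicators of the window and of the initial segment below `lo` add up to that of the
  -- segment below `hi`. As the window may reach beyond the support bound `N`, all sums are extended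
  -- to the common length `N + (lo + hi)`.
  ∑<-window : ∀ N lo hi {P : ℕ → Set} (P? : Decidable P) (f : ℕ → ℕ) → lo ≤ hi →
    (∀ x → N ≤ x → f x ≡ 0) → (∀ x → P x ⇔ (lo ≤ x × x < hi)) →
    ∑< N (λ x → χ (does (P? x)) * f x) + ∑< lo f ≡ ∑< hi f
  ∑<-window N lo hi P? f lo≤hi vanishes P⇔ = begin
    ∑< N (λ x → χ (does (P? x)) * f x) + ∑< lo f
      ≡⟨ cong₂ _+_ (∑<-extend N (lo + hi) (λ x N≤x →
           trans (cong (χ (does (P? x)) *_) (vanishes x N≤x)) (*-zeroʳ (χ (does (P? x))))))
         (∑<-restrict lo (N + hi) f) ⟨
    ∑< (N + (lo + hi)) (λ x → χ (does (P? x)) * f x) + ∑< (lo + (N + hi)) (λ x → χ (does (x <? lo)) * f x)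
      ≡⟨ cong (λ M → ∑< (N + (lo + hi)) (λ x → χ (does (P? x)) * f x) + ∑< M (λ x → χ (does (x <? lo)) * f x)) (left N lo hi) ⟩
    ∑< (N + (lo + hi)) (λ x → χ (does (P? x)) * f x) + ∑< (N + (lo + hi)) (λ x → χ (does (x <? lo)) * f x)
      ≡⟨ ∑<-+ (N + (lo + hi)) _ _ ⟨
    ∑< (N + (lo + hi)) (λ x → χ (does (P? x)) * f x + χ (does (x <? lo)) * f x)
      ≡⟨ ∑<-cong (N + (lo + hi)) (λ x _ → trans (sym (*-distribʳ-+ (f x) (χ (does (P? x))) _)) (cong (_* f x) (indicators x))) ⟩
    ∑< (N + (lo + hi)) (λ x → χ (does (x <? hi)) * f x)
      ≡⟨ cong (λ M → ∑< M (λ x → χ (does (x <? hi)) * f x)) (right N lo hi) ⟩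
    ∑< (hi + (N + lo)) (λ x → χ (does (x <? hi)) * f x)
      ≡⟨ ∑<-restrict hi (N + lo) f ⟩
    ∑< hi f ∎
    where
    left : ∀ a b c → b + (a + c) ≡ a + (b + c)
    left = solve-∀
    right : ∀ a b c → a + (b + c) ≡ c + (a + b)
    right = solve-∀
    indicators : ∀ x → χ (does (P? x)) + χ (does (x <? lo)) ≡ χ (does (x <? hi))
    indicators x with x <? lo
    ... | yes x<lo = trans
      (cong₂ _+_ (χ-false (P? x) (λ p → <⇒≱ x<lo (proj₁ (Equivalence.to (P⇔ x) p)))) (χ-true (x <? lo) x<lo))
      (sym (χ-true (x <? hi) (<-≤-trans x<lo lo≤hi)))
    ... | no x≮lo = trans (trans (cong (χ (does (P? x)) +_) (χ-false (x <? lo) x≮lo)) (+-identityʳ _)) (cong χ (does-⇔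
      (mk⇔ (λ p → proj₂ (Equivalence.to (P⇔ x) p)) (λ x<hi → Equivalence.from (P⇔ x) (≮⇒≥ x≮lo , x<hi)))
      (P? x) (x <? hi)))

  length-concatMap-filter : ∀ {A : Set} {P : ℕ → Set} (P? : Decidable P) (g : ℕ → List A) n →
    length (concatMap g (filter P? (downFrom n))) ≡ ∑< n (λ x → χ (does (P? x)) * length (g x))
  length-concatMap-filter P? g zero = refl
  length-concatMap-filter P? g (suc n) with does (P? n)
  ... | true  = trans (List.length-++ (g n)) (trans
    (cong (length (g n) +_) (length-concatMap-filter P? g n))
    (trans (+-comm (length (g n)) _) (cong (∑< n (λ x → χ (does (P? x)) * length (g x)) +_) (sym (*-identityˡ (length (g n)))))))
  ... | false = trans (length-concatMap-filter P? g n) (sym (+-identityʳ _))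

  -- 0 < x′ / t′ - x / t < 1
  Step : ℕ → ℕ → ℕ → ℕ → Set
  Step t x t′ x′ = x * t′ < x′ * t × x′ * t < (x + t) * t′

  step? : ∀ t x t′ x′ → Dec (Step t x t′ x′)
  step? t x t′ x′ = (x * t′ <? x′ * t) ×-dec (x′ * t <? (x + t) * t′)

  -- The sequences x₁, …, xⱼ = x that satisfy Step consecutively, starting from x₀ = 0.
  -- Hence t 0 only matters in being positive.
  chains : (ℕ → ℕ) → ∀ j → ℕ → List (Vec ℤ j)
  chains t zero    zero    = [] ∷ []
  chains t zero    (suc x) = []
  chains t (suc j) x′ = List.map (_∷ʳ ℤ.+ x′)
    (concatMap (chains t j) (filter (λ x → step? (t j) x (t (suc j)) x′) (downFrom (suc (j * t j)))))

  opaque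

    count : (ℕ → ℕ) → ℕ → ℕ → ℕ
    count t j x = length (chains t j x)

    count-chains : ∀ t j x → count t j x ≡ length (chains t j x)
    count-chains t j x = refl

  count-suc : ∀ t j x′ → count t (suc j) x′ ≡
    ∑< (suc (j * t j)) (λ x → χ (does (step? (t j) x (t (suc j)) x′)) * count t j x)
  count-suc t j x′ = begin
    count t (suc j) x′
      ≡⟨ count-chains t (suc j) x′ ⟩
    length (chains t (suc j) x′)
      ≡⟨ List.length-map (_∷ʳ ℤ.+ x′) (concatMap (chains t j) (filter step-to (downFrom (suc (j * t j))))) ⟩
    length (concatMap (chains t j) (filter step-to (downFrom (suc (j * t j)))))
      ≡⟨ length-concatMap-filter step-to (chains t j) (suc (j * t j)) ⟩
    ∑< (suc (j * t j)) (λ x → χ (does (step-to x)) * length (chains t j x))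
      ≡⟨ ∑<-cong (suc (j * t j)) (λ x _ → cong (χ (does (step-to x)) *_) (count-chains t j x)) ⟨
    ∑< (suc (j * t j)) (λ x → χ (does (step-to x)) * count t j x) ∎
    where
    step-to : ∀ x → Dec (Step (t j) x (t (suc j)) x′)
    step-to x = step? (t j) x (t (suc j)) x′

  ∑<-zero : ∀ n {f : ℕ → ℕ} → (∀ x → x < n → f x ≡ 0) → ∑< n f ≡ 0
  ∑<-zero zero    e = refl
  ∑<-zero (suc n) e = cong₂ _+_ (∑<-zero n (λ x x<n → e x (m<n⇒m<1+n x<n))) (e n ≤-refl)

  -- Each step raises the ratio by less than 1, so the ratio at level `j` is at most `j`. This
  -- justifies the finite range of predecessors in `chains`.
  step-bound : ∀ {t x t′ x′} j → x ≤ j * t → Step t x t′ x′ → x′ < suc j * t′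
  step-bound {t} {x} {t′} {x′} j x≤jt (_ , x′t<[x+t]t′) = *-cancelʳ-< t x′ (suc j * t′)
    (<-≤-trans x′t<[x+t]t′ (≤-trans
      (*-monoˡ-≤ t′ (≤-trans (+-monoˡ-≤ t x≤jt) (≤-reflexive (+-comm (j * t) t))))
      (≤-reflexive (swapped (suc j) t t′))))
    where
    swapped : ∀ a b c → a * b * c ≡ a * c * b
    swapped = solve-∀

  count-beyond : ∀ t j x → suc j * t (suc j) ≤ x → count t (suc j) x ≡ 0
  count-beyond t j x′ bound≤x′ = trans (count-suc t j x′) (∑<-zero (suc (j * t j)) λ x x≤jt →
    cong (_* count t j x) (χ-false (step? (t j) x (t (suc j)) x′)
      (λ step → <⇒≱ (step-bound {t j} {x} {t (suc j)} {x′} j (ℕ.s≤s⁻¹ x≤jt) step) bound≤x′)))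

  count-vanishes : ∀ t j x → suc (j * t j) ≤ x → count t j x ≡ 0
  count-vanishes t zero    (suc x) _    = count-chains t 0 (suc x)
  count-vanishes t (suc j) x       jt<x = count-beyond t j x (<⇒≤ jt<x)

  -- Replacing the ratio at every level `j` by `j` minus it turns an increment `δ` into `1 - δ`, so
  -- steps go to steps.
  count-reflect : ∀ t j x y → x + y ≡ j * t j → count t j x ≡ count t j y
  count-reflect t zero    zero    zero    _   = refl
  count-reflect t (suc j) x′      y′      x′+y′≡ = begin
    count t (suc j) x′
      ≡⟨ count-suc t j x′ ⟩
    ∑< (suc N) (λ x → χ (does (step? (t j) x (t (suc j)) x′)) * count t j x)
      ≡⟨ ∑<-reverse N (λ x → χ (does (step? (t j) x (t (suc j)) x′)) * count t j x) ⟩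
    ∑< (suc N) (λ x → χ (does (step? (t j) (N ∸ x) (t (suc j)) x′)) * count t j (N ∸ x))
      ≡⟨ ∑<-cong (suc N) (λ x x≤N → let complement = m∸n+n≡m (ℕ.s≤s⁻¹ x≤N) in cong₂ _*_
           (cong χ (does-⇔ (mk⇔ (reflected (N ∸ x) x x′ y′ complement x′+y′≡)
                                (reflected x (N ∸ x) y′ x′ (trans (+-comm x (N ∸ x)) complement) (trans (+-comm y′ x′) x′+y′≡)))
                           (step? (t j) (N ∸ x) (t (suc j)) x′) (step? (t j) x (t (suc j)) y′)))
           (count-reflect t j (N ∸ x) x complement)) ⟩
    ∑< (suc N) (λ x → χ (does (step? (t j) x (t (suc j)) y′)) * count t j x)
      ≡⟨ count-suc t j y′ ⟨
    count t (suc j) y′ ∎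
    where
    N = j * t j
    -- The increments of the two chains add up to 1, here cleared of denominators and subtraction.
    -- Either half of `Step` for one chain thus becomes the other half for its reflection.
    balance : ∀ j t t′ x y x′ y′ → x + y ≡ j * t → x′ + y′ ≡ suc j * t′ → y′ * t + x′ * t ≡ x * t′ + (y + t) * t′
    balance j t t′ x y x′ y′ e e′ = begin
      y′ * t + x′ * t          ≡⟨ *-distribʳ-+ t y′ x′ ⟨
      (y′ + x′) * t            ≡⟨ cong (_* t) (trans (+-comm y′ x′) e′) ⟩
      suc j * t′ * t           ≡⟨ regroup j t t′ ⟩
      (j * t + t) * t′         ≡⟨ cong (λ n → (n + t) * t′) e ⟨
      (x + y + t) * t′         ≡⟨ spread x y t t′ ⟩
      x * t′ + (y + t) * t′    ∎
      where
      regroup : ∀ j t t′ → suc j * t′ * t ≡ (j * t + t) * t′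
      regroup = solve-∀
      spread : ∀ x y t t′ → (x + y + t) * t′ ≡ x * t′ + (y + t) * t′
      spread = solve-∀
    reflected : ∀ x y x′ y′ → x + y ≡ j * t j → x′ + y′ ≡ suc j * t (suc j) →
      Step (t j) x (t (suc j)) x′ → Step (t j) y (t (suc j)) y′
    reflected x y x′ y′ e e′ (p , q) =
        +-cancelˡ-< (x′ * t j) _ _ (subst₂ _<_
          (+-comm (y * t (suc j)) (x′ * t j))
          (sym (balance j (t j) (t (suc j)) y x y′ x′ (trans (+-comm y x) e) (trans (+-comm y′ x′) e′)))
          (+-monoʳ-< (y * t (suc j)) q))
      , +-cancelˡ-< (x * t (suc j)) _ _ (subst₂ _<_
          (+-comm (y′ * t j) (x * t (suc j)))
          (balance j (t j) (t (suc j)) x y x′ y′ e e′)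
          (+-monoʳ-< (y′ * t j) p))

  -- The predecessors of a value form an interval.

  <-scale : ∀ ℓ i {x y} → i ≤ ℓ → x * suc ℓ + i < y * suc ℓ ⇔ x < y
  <-scale ℓ i {x} {y} i≤ℓ = mk⇔
    (λ lt → *-cancelʳ-< (suc ℓ) x y (≤-<-trans (m≤m+n _ i) lt))
    (λ x<y → <-≤-trans (+-monoʳ-< (x * suc ℓ) (s≤s i≤ℓ))
      (≤-trans (≤-reflexive (+-comm (x * suc ℓ) (suc ℓ))) (*-monoˡ-≤ (suc ℓ) x<y)))

  ≤-scale : ∀ ℓ i {x y} → suc i ≤ ℓ → x * suc ℓ < y * suc ℓ + suc i ⇔ x ≤ y
  ≤-scale ℓ i {x} {y} i<ℓ = mk⇔
    (λ lt → ≮⇒≥ (λ y<x → <⇒≱ lt (<⇒≤ (Equivalence.from (<-scale ℓ (suc i) i<ℓ) y<x))))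
    (λ x≤y → ≤-<-trans (*-monoˡ-≤ (suc ℓ) x≤y) (m<m+n (y * suc ℓ) ℕ.z<s))

  module _ (r : ℕ) .{{_ : NonZero r}} where

    sᵗ μᵗ : ℕ → ℕ
    sᵗ j = suc j * r
    μᵗ   = 1 ◂ sᵗ

    module _ (ℓ A i : ℕ) where

      -- Rescaling from the term `(ℓ + 1) r` to `ℓ r` multiplies by `ℓ / (ℓ + 1)`, which takes
      -- `(ℓ + 1) A + i` to `ℓ A + i` less the fraction `i / (ℓ + 1)`. For `i ≤ ℓ` the fraction is
      -- below 1, so `A` and `i` survive the passage between levels.
      position : (suc ℓ * A + i) * ℓ + i ≡ (ℓ * A + i) * suc ℓ
      position = shape ℓ A i
        where
        shape : ∀ ℓ A i → (suc ℓ * A + i) * ℓ + i ≡ (ℓ * A + i) * suc ℓ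
        shape = solve-∀

      first⇔ : i ≤ ℓ → ∀ x → x * (suc ℓ * r) < (suc ℓ * A + i) * (ℓ * r) ⇔ x < ℓ * A + i
      first⇔ i≤ℓ x = mk⇔
        (λ lt → Equivalence.to (<-scale ℓ i i≤ℓ) (subst (x * suc ℓ + i <_) position
          (+-monoˡ-< i (*-cancelʳ-< r _ _ (subst₂ _<_ (sym (*-assoc x (suc ℓ) r)) (sym (*-assoc (suc ℓ * A + i) ℓ r)) lt)))))
        (λ x<y → subst₂ _<_ (*-assoc x (suc ℓ) r) (*-assoc (suc ℓ * A + i) ℓ r) (*-monoˡ-< r
          (+-cancelʳ-< i _ _ (subst (x * suc ℓ + i <_) (sym position) (Equivalence.from (<-scale ℓ i i≤ℓ) x<y)))))

      second⇔ : ∀ w → (suc ℓ * A + i) * (ℓ * r) < w * (suc ℓ * r) ⇔ (ℓ * A + i) * suc ℓ < w * suc ℓ + i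
      second⇔ w = mk⇔
        (λ lt → subst (_< w * suc ℓ + i) position
          (+-monoˡ-< i (*-cancelʳ-< r _ _ (subst₂ _<_ (sym (*-assoc (suc ℓ * A + i) ℓ r)) (sym (*-assoc w (suc ℓ) r)) lt))))
        (λ lt → subst₂ _<_ (*-assoc (suc ℓ * A + i) ℓ r) (*-assoc w (suc ℓ) r) (*-monoˡ-< r
          (+-cancelʳ-< i _ _ (subst (_< w * suc ℓ + i) (sym position) lt))))

      LowerEnd : ℕ → Set
      LowerEnd lo = ∀ x → (suc ℓ * A + i) * (ℓ * r) < (x + ℓ * r) * (suc ℓ * r) ⇔ lo ≤ x

      -- The level `j` and the multiplier `ℓ` are separate because `μᵗ` reaches `ℓ r` at level `ℓ`
      -- but `sᵗ` one level earlier. Both have the same windows, which makes adding their counts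
      -- possible.
      count-window : ∀ t j lo → t j ≡ ℓ * r → t (suc j) ≡ suc ℓ * r → i ≤ ℓ → lo ≤ ℓ * A + i → LowerEnd lo →
        count t (suc j) (suc ℓ * A + i) + ∑< lo (count t j) ≡ ∑< (ℓ * A + i) (count t j)
      count-window t j lo tj≡ tj′≡ i≤ℓ lo≤hi lower = trans
        (cong (_+ ∑< lo (count t j)) (count-suc t j (suc ℓ * A + i)))
        (∑<-window (suc (j * t j)) lo (ℓ * A + i)
          (λ x → step? (t j) x (t (suc j)) (suc ℓ * A + i)) (count t j) lo≤hi (count-vanishes t j)
          step⇔)
        where
        step⇔ : ∀ x → Step (t j) x (t (suc j)) (suc ℓ * A + i) ⇔ (lo ≤ x × x < ℓ * A + i)
        step⇔ x rewrite tj≡ | tj′≡ = mk⇔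
          (λ (a , b) → Equivalence.to (lower x) b , Equivalence.to (first⇔ i≤ℓ x) a)
          (λ (b , a) → Equivalence.from (first⇔ i≤ℓ x) a , Equivalence.from (lower x) b)

    module _ (n : ℕ) where
      private
        ℓ = suc n

      -- The ratio of the value is below 1 here, so even the predecessor 0 is less than 1 away.
      lowerEnd-below : ∀ {A i} → A < r → i ≤ ℓ → LowerEnd ℓ A i 0
      lowerEnd-below {A} {i} A<r i≤ℓ x = mk⇔ (λ _ → z≤n) (λ _ → Equivalence.from (second⇔ ℓ A i (x + ℓ * r)) (bound i i≤ℓ))
        where
        ℓA+ℓ≤ : ℓ * A + ℓ ≤ x + ℓ * r
        ℓA+ℓ≤ = ≤-trans (≤-reflexive (trans (+-comm (ℓ * A) ℓ) (sym (*-suc ℓ A))))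
          (≤-trans (*-monoʳ-≤ ℓ A<r) (m≤n+m (ℓ * r) x))
        bound : ∀ i → i ≤ ℓ → (ℓ * A + i) * suc ℓ < (x + ℓ * r) * suc ℓ + i
        bound zero    _   = <-≤-trans (*-monoˡ-< (suc ℓ) (<-≤-trans (+-monoʳ-< (ℓ * A) {0} {ℓ} (s≤s z≤n)) ℓA+ℓ≤)) (m≤m+n _ 0)
        bound (suc i) i<ℓ = Equivalence.from (≤-scale ℓ i i<ℓ) (≤-trans (+-monoʳ-≤ (ℓ * A) i<ℓ) ℓA+ℓ≤)

      lowerEnd-suc : ∀ {A i} → suc i ≤ ℓ → LowerEnd ℓ (A + r) (suc i) (ℓ * A + suc i)
      lowerEnd-suc {A} {i} i<ℓ x = mk⇔
        (λ lt → +-cancelʳ-≤ (ℓ * r) _ _ (subst (_≤ x + ℓ * r) (shape ℓ A r (suc i))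
          (Equivalence.to (≤-scale ℓ i i<ℓ) (Equivalence.to (second⇔ ℓ (A + r) (suc i) (x + ℓ * r)) lt))))
        (λ le → Equivalence.from (second⇔ ℓ (A + r) (suc i) (x + ℓ * r)) (Equivalence.from (≤-scale ℓ i i<ℓ)
          (subst (_≤ x + ℓ * r) (sym (shape ℓ A r (suc i))) (+-monoˡ-≤ (ℓ * r) le))))
        where
        shape : ∀ ℓ A r i → ℓ * (A + r) + i ≡ ℓ * A + i + ℓ * r
        shape = solve-∀

      -- The rescaled lower limit is the integer `ℓ A` itself, and the strict inequality excludes
      -- it. For a positive remainder the limit falls strictly between two integers and nothing is
      -- lost. This single missing point is the source of the additional term in `F-zero`.
      lowerEnd-zero : ∀ {A} → LowerEnd ℓ (A + r) 0 (suc (ℓ * A))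
      lowerEnd-zero {A} x = mk⇔
        (λ lt → +-cancelʳ-< (ℓ * r) _ _ (subst (_< x + ℓ * r) (shape ℓ A r)
          (*-cancelʳ-< (suc ℓ) _ _ (subst ((ℓ * (A + r) + 0) * suc ℓ <_) (+-identityʳ _)
            (Equivalence.to (second⇔ ℓ (A + r) 0 (x + ℓ * r)) lt)))))
        (λ le → Equivalence.from (second⇔ ℓ (A + r) 0 (x + ℓ * r)) (subst ((ℓ * (A + r) + 0) * suc ℓ <_) (sym (+-identityʳ _))
          (*-monoˡ-< (suc ℓ) (subst (_< x + ℓ * r) (sym (shape ℓ A r)) (+-monoˡ-< (ℓ * r) le)))))
        where
        shape : ∀ ℓ A r → ℓ * (A + r) + 0 ≡ ℓ * A + ℓ * r
        shape = solve-∀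

      -- Since sᵗ is μᵗ without level 0, the first summand counts the chains that pass
      -- through 0 at level 1 of μᵗ.
      Φ : ℕ → ℕ
      Φ x = count sᵗ n x + count μᵗ (suc n) x

    Φ-window : ∀ n A i lo → i ≤ suc n → lo ≤ suc n * A + i → LowerEnd (suc n) A i lo →
      Φ (suc n) (suc (suc n) * A + i) + ∑< lo (Φ n) ≡ ∑< (suc n * A + i) (Φ n)
    Φ-window n A i lo i≤ℓ lo≤hi lower = begin
      a + b + ∑< lo (Φ n)
        ≡⟨ cong (a + b +_) (∑<-+ lo (count sᵗ n) (count μᵗ (suc n))) ⟩
      a + b + (∑< lo (count sᵗ n) + ∑< lo (count μᵗ (suc n)))
        ≡⟨ interchanged a b (∑< lo (count sᵗ n)) (∑< lo (count μᵗ (suc n))) ⟩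
      a + ∑< lo (count sᵗ n) + (b + ∑< lo (count μᵗ (suc n)))
        ≡⟨ cong₂ _+_ (count-window (suc n) A i sᵗ n lo refl refl i≤ℓ lo≤hi lower)
                     (count-window (suc n) A i μᵗ (suc n) lo refl refl i≤ℓ lo≤hi lower) ⟩
      ∑< (suc n * A + i) (count sᵗ n) + ∑< (suc n * A + i) (count μᵗ (suc n))
        ≡⟨ ∑<-+ (suc n * A + i) (count sᵗ n) (count μᵗ (suc n)) ⟨
      ∑< (suc n * A + i) (Φ n) ∎
      where
      a = count sᵗ (suc n) (suc (suc n) * A + i)
      b = count μᵗ (suc (suc n)) (suc (suc n) * A + i)
      interchanged : ∀ a b c d → a + b + (c + d) ≡ a + c + (b + d)
      interchanged = solve-∀

    Φ-below : ∀ n {A i} → A < r → i ≤ suc n → Φ (suc n) (suc (suc n) * A + i) ≡ ∑< (suc n * A + i) (Φ n)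
    Φ-below n {A} {i} A<r i≤ℓ = trans (sym (+-identityʳ _)) (Φ-window n A i 0 i≤ℓ z≤n (lowerEnd-below n A<r i≤ℓ))

    Φ-suc : ∀ n A {i} → i ≤ n →
      Φ (suc n) (suc (suc n) * (A + r) + suc i) + ∑< (suc n * A + suc i) (Φ n) ≡ ∑< (suc n * (A + r) + suc i) (Φ n)
    Φ-suc n A {i} i≤n = Φ-window n (A + r) (suc i) (suc n * A + suc i) (s≤s i≤n)
      (+-monoˡ-≤ (suc i) (*-monoʳ-≤ (suc n) (m≤m+n A r))) (lowerEnd-suc n (s≤s i≤n))

    Φ-zero : ∀ n A →
      Φ (suc n) (suc (suc n) * (A + r) + 0) + (∑< (suc n * A) (Φ n) + Φ n (suc n * A)) ≡ ∑< (suc n * (A + r) + 0) (Φ n)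
    Φ-zero n A = Φ-window n (A + r) 0 (suc (suc n * A)) z≤n
      (≤-trans (*-monoʳ-< (suc n) (m<m+n A (ℕ.>-nonZero⁻¹ r))) (≤-reflexive (sym (+-identityʳ _)))) (lowerEnd-zero n)

    -- The empty chain of `sᵗ` supplies the value 0, and the one-step chains of `μᵗ` supply the
    -- values strictly between 0 and `r`.
    Φ-start : ∀ x → Φ 0 x ≡ χ (does (x <? r))
    Φ-start zero    = begin
      count sᵗ 0 0 + count μᵗ 1 0
        ≡⟨ cong₂ _+_ (count-chains sᵗ 0 0) (count-suc μᵗ 0 0) ⟩
      1 + χ (does (step? 1 0 (1 * r) 0)) * count μᵗ 0 0
        ≡⟨ cong (λ n → suc (n * count μᵗ 0 0)) (χ-false (step? 1 0 (1 * r) 0) (λ { (() , _) })) ⟩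
      1
        ≡⟨ χ-true (0 <? r) (ℕ.>-nonZero⁻¹ r) ⟨
      χ (does (0 <? r)) ∎
    Φ-start (suc x) = begin
      count sᵗ 0 (suc x) + count μᵗ 1 (suc x)
        ≡⟨ cong₂ _+_ (count-chains sᵗ 0 (suc x)) (count-suc μᵗ 0 (suc x)) ⟩
      χ (does (step? 1 0 (1 * r) (suc x))) * count μᵗ 0 0
        ≡⟨ trans (cong (χ (does (step? 1 0 (1 * r) (suc x))) *_) (count-chains μᵗ 0 0)) (*-identityʳ _) ⟩
      χ (does (step? 1 0 (1 * r) (suc x)))
        ≡⟨ cong χ step⇔< ⟩
      χ (does (suc x <? r)) ∎
      where
      step⇔< = does-⇔ (mk⇔
        (λ (_ , lt) → subst₂ _<_ (*-identityʳ (suc x)) (trans (+-identityʳ (1 * r)) (+-identityʳ r)) lt)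
        (λ lt → s≤s z≤n , subst₂ _<_ (sym (*-identityʳ (suc x))) (sym (trans (+-identityʳ (1 * r)) (+-identityʳ r))) lt))
        (step? 1 0 (1 * r) (suc x)) (suc x <? r)

  -- The height coordinate of Π° appears as one more level, with tₘ₊₁ = 1.
  cap : ℕ → (ℕ → ℕ) → ℕ → ℕ
  cap zero    t = t 0 ◂ const 1
  cap (suc m) t = t 0 ◂ cap m (t ∘ suc)

  cap-≤ : ∀ m t {i} → i ≤ m → cap m t i ≡ t i
  cap-≤ zero    t z≤n       = refl
  cap-≤ (suc m) t z≤n       = refl
  cap-≤ (suc m) t (s≤s i≤m) = cap-≤ m (t ∘ suc) i≤m

  cap-suc : ∀ m t → cap m t (suc m) ≡ 1
  cap-suc zero    t = refl
  cap-suc (suc m) t = cap-suc m (t ∘ suc)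

  cap-nonZero : ∀ m t → (∀ i → NonZero (t i)) → ∀ i → NonZero (cap m t i)
  cap-nonZero zero    t nz zero    = nz 0
  cap-nonZero zero    t nz (suc i) = _
  cap-nonZero (suc m) t nz zero    = nz 0
  cap-nonZero (suc m) t nz (suc i) = cap-nonZero m (t ∘ suc) (nz ∘ suc) i

  count-cong : ∀ {t t′} j x → (∀ i → i ≤ j → t i ≡ t′ i) → count t j x ≡ count t′ j x
  count-cong {t} {t′} zero zero    e = trans (count-chains t 0 0) (sym (count-chains t′ 0 0))
  count-cong {t} {t′} zero (suc x) e = trans (count-chains t 0 (suc x)) (sym (count-chains t′ 0 (suc x)))
  count-cong {t} {t′} (suc j) x′ e = begin
    count t (suc j) x′
      ≡⟨ count-suc t j x′ ⟩
    ∑< (suc (j * t j)) (λ x → χ (does (step? (t j) x (t (suc j)) x′)) * count t j x)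
      ≡⟨ cong₂ (λ a b → ∑< (suc (j * a)) (λ x → χ (does (step? a x b x′)) * count t j x)) (e j (n≤1+n j)) (e (suc j) ≤-refl) ⟩
    ∑< (suc (j * t′ j)) (λ x → χ (does (step? (t′ j) x (t′ (suc j)) x′)) * count t j x)
      ≡⟨ ∑<-cong (suc (j * t′ j)) (λ x _ → cong (χ (does (step? (t′ j) x (t′ (suc j)) x′)) *_)
           (count-cong j x (λ i i≤j → e i (m≤n⇒m≤1+n i≤j)))) ⟩
    ∑< (suc (j * t′ j)) (λ x → χ (does (step? (t′ j) x (t′ (suc j)) x′)) * count t′ j x)
      ≡⟨ count-suc t′ j x′ ⟨
    count t′ (suc j) x′ ∎

  step-scale : ∀ t x k h .{{_ : NonZero k}} → Step t x 1 h ⇔ Step t x k (k * h)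
  step-scale t x k h = mk⇔
    (λ (p , q) →
        subst₂ _<_ (cong (_* k) (*-identityʳ x)) (scaled h) (*-monoˡ-< k p)
      , subst₂ _<_ (scaled h) (cong (_* k) (*-identityʳ (x + t))) (*-monoˡ-< k q))
    (λ (p , q) →
        *-cancelʳ-< k _ _ (subst₂ _<_ (sym (cong (_* k) (*-identityʳ x))) (sym (scaled h)) p)
      , *-cancelʳ-< k _ _ (subst₂ _<_ (sym (scaled h)) (sym (cong (_* k) (*-identityʳ (x + t)))) q))
    where
    scaled : ∀ h → h * t * k ≡ k * h * t
    scaled h = trans (*-comm (h * t) k) (sym (*-assoc k h t))

  -- Only ratios matter for a step, and `h / 1` is also the ratio of `t (suc m) * h` to `t (suc m)`.
  -- Hence the term after the last one can be chosen freely, in particular so as to continue the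
  -- sequence.
  count-cap : ∀ m t h .{{_ : NonZero (t (suc m))}} → count (cap m t) (suc m) h ≡ count t (suc m) (t (suc m) * h)
  count-cap m t h = begin
    count (cap m t) (suc m) h
      ≡⟨ count-suc (cap m t) m h ⟩
    ∑< (suc (m * cap m t m)) (λ x → χ (does (step? (cap m t m) x (cap m t (suc m)) h)) * count (cap m t) m x)
      ≡⟨ cong₂ (λ a b → ∑< (suc (m * a)) (λ x → χ (does (step? a x b h)) * count (cap m t) m x)) (cap-≤ m t ≤-refl) (cap-suc m t) ⟩
    ∑< (suc (m * t m)) (λ x → χ (does (step? (t m) x 1 h)) * count (cap m t) m x)
      ≡⟨ ∑<-cong (suc (m * t m)) (λ x _ → cong₂ _*_
           (cong χ (does-⇔ (step-scale (t m) x (t (suc m)) h) (step? (t m) x 1 h) (step? (t m) x (t (suc m)) (t (suc m) * h))))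
           (count-cong m x (λ i i≤m → cap-≤ m t i≤m))) ⟩
    ∑< (suc (m * t m)) (λ x → χ (does (step? (t m) x (t (suc m)) (t (suc m) * h))) * count t m x)
      ≡⟨ count-suc t m (t (suc m) * h) ⟨
    count t (suc m) (t (suc m) * h) ∎

  -- Chains as a relation, and the list of lattice points.

  -- Built from the front with an arbitrary start, which suits the geometry, whereas `chains` grows
  -- at the back, which suits the recurrence; `snoc` and `unsnoc` mediate.
  data Chain (t : ℕ → ℕ) (x : ℕ) : ∀ {n} → Vec ℤ n → ℕ → Set where
    []  : Chain t x [] x
    _∷_ : ∀ {n x′ y} {v : Vec ℤ n} → Step (t 0) x (t 1) x′ → Chain (t ∘ suc) x′ v y → Chain t x (ℤ.+ x′ ∷ v) y

  snoc : ∀ {n t x y y′} {v : Vec ℤ n} → Chain t x v y → Step (t n) y (t (suc n)) y′ → Chain t x (v ∷ʳ ℤ.+ y′) y′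
  snoc []       s = s ∷ []
  snoc (s′ ∷ c) s = s′ ∷ snoc c s

  unsnoc : ∀ {n t x y′ w} (v : Vec ℤ n) → Chain t x (v ∷ʳ w) y′ →
           ∃[ y ] Chain t x v y × Step (t n) y (t (suc n)) y′ × w ≡ ℤ.+ y′
  unsnoc []      (s ∷ []) = _ , [] , s , refl
  unsnoc (_ ∷ v) (s ∷ c) with y , c′ , s′ , e ← unsnoc v c = y , s ∷ c′ , s′ , e

  chain-end : ∀ {n t x y y′} {v : Vec ℤ n} → Chain t x v y → Chain t x v y′ → y ≡ y′
  chain-end []      []       = refl
  chain-end (_ ∷ c) (_ ∷ c′) = chain-end c c′

  ∈-chains-bound : ∀ {t} j {x} {v : Vec ℤ j} → v ∈ chains t j x → x < suc (j * t j)
  ∈-chains-bound {t} j {x} v∈ = ≰⇒> (λ bound → nonempty v∈ (trans (sym (count-chains t j x)) (count-vanishes t j x bound)))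
    where
    nonempty : ∀ {v : Vec ℤ j} {xs} → v ∈ xs → length xs ≢ 0
    nonempty (here _)  ()
    nonempty (there _) ()

  ∈-chains⁻ : ∀ {t} j {x} {v : Vec ℤ j} → v ∈ chains t j x → Chain t 0 v x
  ∈-chains⁻ zero {zero} (here refl) = []
  ∈-chains⁻ {t} (suc j) {x′} v∈
    with v′ , v′∈ , refl ← ∈-map⁻ (_∷ʳ ℤ.+ x′) v∈
    with x , x∈ , v′∈chains ← find (∈-concatMap⁻ (chains t j) v′∈)
    with _ , s ← ∈-filter⁻ (λ x → step? (t j) x (t (suc j)) x′) {xs = downFrom (suc (j * t j))} x∈ =
    snoc (∈-chains⁻ j v′∈chains) s

  ∈-chains⁺ : ∀ {t} j {x} {v : Vec ℤ j} → Chain t 0 v x → v ∈ chains t j x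
  ∈-chains⁺ zero    [] = here refl
  ∈-chains⁺ {t} (suc j) {x′} {v} c with initLast v
  ... | v′ , w , refl with y , c′ , s , refl ← unsnoc v′ c =
    ∈-map⁺ (_∷ʳ ℤ.+ x′) (∈-concatMap⁺ (chains t j)
      (lose (∈-filter⁺ (λ x → step? (t j) x (t (suc j)) x′) (∈-downFrom⁺ (∈-chains-bound j v′∈)) s) v′∈))
    where
    v′∈ = ∈-chains⁺ j c′

  concatMap-chains-unique : ∀ t j {xs} → Unique xs → (∀ x → Unique (chains t j x)) → Unique (concatMap (chains t j) xs)
  concatMap-chains-unique t j {xs} unique-xs unique = Unique.concat⁺
    (All.map⁺ (All.universal unique xs))
    (ListAllPairs.map⁺ (ListAllPairs.map
      (λ x≢y {_} (v∈x , v∈y) → x≢y (chain-end (∈-chains⁻ j v∈x) (∈-chains⁻ j v∈y))) unique-xs))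

  chains-unique : ∀ t j x → Unique (chains t j x)
  chains-unique t zero    zero    = [] ∷ []
  chains-unique t zero    (suc x) = []
  chains-unique t (suc j) x′      = Unique.map⁺ (Vec.∷ʳ-injectiveˡ _ _)
    (concatMap-chains-unique t j (Unique.filter⁺ (λ x → step? (t j) x (t (suc j)) x′) (Unique.downFrom⁺ (suc (j * t j))))
      (chains-unique t j))

  module _ (t : ℕ → ℕ) (m : ℕ) where

    allChains : ℕ → List (Vec ℤ (suc m))
    allChains N = concatMap (chains t (suc m)) (downFrom N)

    private
      endsAt : ℕ → List (Vec ℤ (suc m)) → List (Vec ℤ (suc m))
      endsAt k = filter (λ v → last v ℤ.≟ ℤ.+ k)

    last-chains : ∀ x → All (λ v → last v ≡ ℤ.+ x) (chains t (suc m) x)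
    last-chains x = All.map⁺ (All.universal (λ v → Vec.last-∷ʳ (ℤ.+ x) v) _)

    allChains-suc : ∀ N k → length (endsAt k (allChains (suc N))) ≡
                    length (endsAt k (chains t (suc m) N)) + length (endsAt k (allChains N))
    allChains-suc N k = trans
      (cong length (List.filter-++ (λ v → last v ℤ.≟ ℤ.+ k) (chains t (suc m) N) (allChains N)))
      (List.length-++ (endsAt k (chains t (suc m) N)))

    other-end : ∀ {x k} → x ≢ k → length (endsAt k (chains t (suc m) x)) ≡ 0
    other-end {x} {k} x≢k = cong length (List.filter-none (λ v → last v ℤ.≟ ℤ.+ k)
      (All.map (λ e e′ → x≢k (ℤ.+-injective (trans (sym e) e′))) (last-chains x)))

    endsAt-≥ : ∀ N {k} → N ≤ k → length (endsAt k (allChains N)) ≡ 0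
    endsAt-≥ zero    _   = refl
    endsAt-≥ (suc N) N<k = trans (allChains-suc N _) (cong₂ _+_ (other-end (<⇒≢ N<k)) (endsAt-≥ N (<⇒≤ N<k)))

    endsAt-< : ∀ N {k} → k < N → length (endsAt k (allChains N)) ≡ count t (suc m) k
    endsAt-< (suc N) {k} k≤N with N ≟ k
    ... | yes refl = trans (allChains-suc N k) (trans (cong₂ _+_
      (trans (cong length (List.filter-all (λ v → last v ℤ.≟ ℤ.+ k) (last-chains k))) (sym (count-chains t (suc m) k)))
      (endsAt-≥ N ≤-refl)) (+-identityʳ _))
    ... | no N≢k   = trans (allChains-suc N k) (cong₂ _+_ (other-end N≢k) (endsAt-< N (≤∧≢⇒< (ℕ.s≤s⁻¹ k≤N) (N≢k ∘ sym))))

    private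
      N : ℕ
      N = suc (suc m * t (suc m))

    lattice-points : List (Vec ℤ (suc m))
    lattice-points = allChains N

    lattice-points-unique : Unique lattice-points
    lattice-points-unique = concatMap-chains-unique t (suc m) (Unique.downFrom⁺ N) (chains-unique t (suc m))

    ∈-lattice-points : ∀ w → w ∈ lattice-points ⇔ (∃[ h ] Chain t 0 w h)
    ∈-lattice-points w = mk⇔
      (λ w∈ → let h , _ , w∈chains = find (∈-concatMap⁻ (chains t (suc m)) {xs = downFrom N} w∈) in h , ∈-chains⁻ (suc m) w∈chains)
      (λ (h , c) → ∈-concatMap⁺ (chains t (suc m)) (lose (∈-downFrom⁺ (∈-chains-bound (suc m) (∈-chains⁺ (suc m) c))) (∈-chains⁺ (suc m) c)))

    gf-lattice-points : gf last lattice-points ≗ λ k → ℤ.+ count t (suc m) k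
    gf-lattice-points k with k <? N
    ... | yes k<N = cong ℤ.+_ (endsAt-< N k<N)
    ... | no k≮N  = cong ℤ.+_ (trans (endsAt-≥ N (≮⇒≥ k≮N)) (sym (count-vanishes t (suc m) k (≮⇒≥ k≮N))))

open Counting

-- The parameters that belong to derangements.

module _ {a ℓ} (R : CommutativeRing a ℓ) where

  open CommutativeRing R hiding (zero)
  open Recurrence R
  open WordSums R using (above; below; diagonal)
  open import Algebra.Properties.Semiring.Mult semiring using (×-comm-*; ×-congʳ) renaming (_×_ to _·_)
  open import Algebra.Properties.CommutativeMonoid.Mult +-commutativeMonoid using (×-distrib-+)
  open import Relation.Binary.Reasoning.Setoid setoid

  derangementParameters : ∀ z r → (∀ {x y} → (1# + - z) * x ≈ (1# + - z) * y → x ≈ y) → Parameters (suc r)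
  derangementParameters z r cancel = record
    { p        = above z r
    ; q        = below z r
    ; z        = z
    ; u        = u
    ; α        = α
    ; p≈zq     = refl
    ; u+z≈1    = u+z≈1
    ; u-cancel = cancel
    ; α-suc    = λ _ → refl
    ; α-first  = begin
        z * (suc r · 1#)  ≈⟨ ×-comm-* (suc r) z 1# ⟩
        suc r · (z * 1#)  ≈⟨ ×-congʳ (suc r) (*-identityʳ z) ⟩
        z + r · z         ≈⟨ +-comm z (r · z) ⟩
        r · z + z         ∎
    -- The added `z` completes `r · z` to `suc r` copies, which pair with the `suc r` copies of `u`
    -- to give `suc r` times 1.
    ; α-last   = sym (begin
        α (suc r) + z              ≈⟨ +-congʳ (α-closed (suc r)) ⟩
        r · z + suc r · u + z      ≈⟨ +-comm _ z ⟩
        z + (r · z + suc r · u)    ≈⟨ +-assoc _ _ _ ⟨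
        suc r · z + suc r · u      ≈⟨ ×-distrib-+ z u (suc r) ⟨
        suc r · (z + u)            ≈⟨ ×-congʳ (suc r) (trans (+-comm z u) u+z≈1) ⟩
        suc r · 1#                 ∎)
    }
    where
    u = 1# + - z
    α : ℕ → Carrier
    α zero    = diagonal z r
    α (suc a) = α a + u
    u+z≈1 : u + z ≈ 1#
    u+z≈1 = trans (+-assoc _ _ _) (trans (+-congˡ (-‿inverseˡ z)) (+-identityʳ 1#))
    α-closed : ∀ a → α a ≈ r · z + a · u
    α-closed zero    = sym (+-identityʳ _)
    α-closed (suc a) = trans (+-congʳ (α-closed a)) (trans (+-assoc _ _ _) (+-congˡ (+-comm (a · u) u)))

-- The chain counts satisfy the recurrence.

module DerangementSeries where
  open PowerSeries
  open CommutativeRing commutativeRing hiding (zero)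
  open WordSums commutativeRing
  open import Algebra.Properties.Semiring.Exp semiring using (_^_)
  open import Algebra.Properties.Ring ring using ([y-z]x≈yx-zx)

  monomial : ∀ m k → (indeterminate ^ m) k ≡ (if does (ℤ.+ m ℤ.≟ ℤ.+ k) then 1ℤ else 0ℤ)
  monomial zero    zero    = ≡.refl
  monomial zero    (suc k) = ≡.refl
  monomial (suc m) zero    = ≡.refl
  monomial (suc m) (suc k) = ≡.trans (indeterminate-⊛ (indeterminate ^ m) (suc k)) (monomial m k)

  gf-∑ˡ : ∀ {A : Set} (e : A → ℕ) xs → gf (λ x → ℤ.+ e x) xs ≗ ∑ˡ (λ x → indeterminate ^ e x) xs
  gf-∑ˡ e []       k = ≡.refl
  gf-∑ˡ e (x ∷ xs) k rewrite monomial (e x) k with does (ℤ.+ e x ℤ.≟ ℤ.+ k)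
  ... | true  = ≡.cong (λ w → 1ℤ ℤ.+ w) (gf-∑ˡ e xs k)
  ... | false = ≡.trans (gf-∑ˡ e xs k) (≡.sym (ℤ.+-identityˡ _))

  1-z : Poly
  1-z = 1# + - indeterminate

  1-z-* : ∀ p k → (1-z * p) k ≡ p k ℤ.- (z· p) k
  1-z-* p k = ≡.trans ([y-z]x≈yx-zx p 1# indeterminate k)
    (≡.cong₂ ℤ._-_ (⊛-identityˡ p k) (indeterminate-⊛ p k))

  open import Algebra.Properties.AbelianGroup ℤ.+-0-abelianGroup using () renaming (∙-cancelʳ to ℤ-cancelʳ)

  1-z-cancel : ∀ {p q} → 1-z * p ≈ 1-z * q → p ≈ q
  1-z-cancel {p} {q} e zero    = ℤ-cancelʳ (ℤ.- 0ℤ) (p 0) (q 0)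
    (≡.trans (≡.sym (1-z-* p 0)) (≡.trans (e 0) (1-z-* q 0)))
  1-z-cancel {p} {q} e (suc k) = ℤ-cancelʳ (ℤ.- p k) (p (suc k)) (q (suc k))
    (≡.trans (≡.sym (1-z-* p (suc k))) (≡.trans (e (suc k)) (≡.trans (1-z-* q (suc k))
      (≡.cong (λ c → q (suc k) ℤ.- c) (≡.sym (1-z-cancel {p} {q} e k))))))

  module _ (r : ℕ) where
    private
      R = suc r

    F C : ℕ → ℕ → ℕ → Poly
    F n a i k = ℤ.+ Φ R n (suc n ℕ.* (a ℕ.+ R ℕ.* k) ℕ.+ i)
    C n a i k = ℤ.+ ∑< (suc n ℕ.* (a ℕ.+ R ℕ.* k) ℕ.+ i) (Φ R n)

    shifted : ∀ a k → a ℕ.+ R ℕ.* suc k ≡ a ℕ.+ R ℕ.* k ℕ.+ R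
    shifted a k = shape a R k
      where
      shape : ∀ a R k → a ℕ.+ R ℕ.* suc k ≡ a ℕ.+ R ℕ.* k ℕ.+ R
      shape = ℕ-Solver.solve-∀

    unshifted : ∀ {a} → a ℕ.< R → a ℕ.+ R ℕ.* 0 ℕ.< R
    unshifted {a} a<R = ≡.subst (ℕ._< R) (≡.sym (≡.trans (≡.cong (a ℕ.+_) (ℕ.*-zeroʳ R)) (ℕ.+-identityʳ a))) a<R

    ℤ-difference : ∀ {a b c} → a ℕ.+ b ≡ c → ℤ.+ a ≡ ℤ.+ c ℤ.- ℤ.+ b
    ℤ-difference {a} {b} ≡.refl = ≡.sym (≡.trans
      (ℤ.+-assoc (ℤ.+ a) (ℤ.+ b) (ℤ.- ℤ.+ b)) (≡.trans (≡.cong (λ w → ℤ.+ a ℤ.+ w) (ℤ.+-inverseʳ (ℤ.+ b))) (ℤ.+-identityʳ _)))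

    Φ-constant : ∀ {a} → a ℕ.< R → ∀ k → ℤ.+ χ (does (a ℕ.+ R ℕ.* k ℕ.<? R)) ≡ constant 1ℤ k
    Φ-constant {a} a<R zero    = ≡.cong ℤ.+_ (χ-true (a ℕ.+ R ℕ.* 0 ℕ.<? R) (unshifted a<R))
    Φ-constant {a} a<R (suc k) = ≡.cong ℤ.+_ (χ-false (a ℕ.+ R ℕ.* suc k ℕ.<? R)
      (ℕ.≤⇒≯ (≡.subst (R ℕ.≤_) (≡.sym (shifted a k)) (ℕ.m≤n+m R (a ℕ.+ R ℕ.* k)))))

    start : ∀ {a} → a ℕ.< R → F 0 a 0 ≈ 1#
    start {a} a<R k = ≡.trans
      (≡.cong ℤ.+_ (≡.trans (≡.cong (Φ R 0) (simplified (a ℕ.+ R ℕ.* k))) (Φ-start R (a ℕ.+ R ℕ.* k))))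
      (Φ-constant a<R k)
      where
      simplified : ∀ x → 1 ℕ.* x ℕ.+ 0 ≡ x
      simplified = ℕ-Solver.solve-∀

    satisfies : Recurrence.Satisfies commutativeRing
      (derangementParameters commutativeRing indeterminate r (λ {p} {q} → 1-z-cancel {p} {q})) F C
    satisfies = record
      { F-start  = start
      ; F-zero   = λ n {a} a<R k → ≡.trans
          (≡.cong (λ w → F (suc n) a 0 k ℤ.+ w) (indeterminate-⊛ (F n a 0) k))
          (≡.trans (at-zero n a<R k) (≡.sym (1-z-* (C n a 0) k)))
      ; F-suc    = λ n {a} i a<R i≤n k → ≡.trans (at-suc n i a<R i≤n k) (≡.sym (1-z-* (C n a (suc i)) k))
      ; C-suc    = λ n a i _ k → ≡.cong (λ x → ℤ.+ ∑< x (Φ R n)) (ℕ.+-suc (suc n ℕ.* (a ℕ.+ R ℕ.* k)) i)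
      ; C-wrap   = λ n a k → ≡.cong (λ x → ℤ.+ ∑< x (Φ R n)) (wrap n a R k)
      ; C-period = λ n k → ≡.trans (period n k) (≡.sym (indeterminate-⊛ (C n R 0) k))
      }
      where
      wrap : ∀ n a R k → suc n ℕ.* (a ℕ.+ R ℕ.* k) ℕ.+ suc n ≡ suc n ℕ.* (suc a ℕ.+ R ℕ.* k) ℕ.+ 0
      wrap = ℕ-Solver.solve-∀
      period : ∀ n k → C n 0 0 k ≡ (z· C n R 0) k
      period n zero    = ≡.cong (λ x → ℤ.+ ∑< x (Φ R n)) (shape n R)
        where
        shape : ∀ n R → suc n ℕ.* (0 ℕ.+ R ℕ.* 0) ℕ.+ 0 ≡ 0
        shape = ℕ-Solver.solve-∀
      period n (suc k) = ≡.cong (λ x → ℤ.+ ∑< x (Φ R n)) (shape n R k)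
        where
        shape : ∀ n R k → suc n ℕ.* (0 ℕ.+ R ℕ.* suc k) ℕ.+ 0 ≡ suc n ℕ.* (R ℕ.+ R ℕ.* k) ℕ.+ 0
        shape = ℕ-Solver.solve-∀
      -- At `k = 0` the window starts at 0, in accordance with the vanishing constant coefficients
      -- of the shifted series. Raising `k` by one adds `R` to `a + R k`, so later windows lie
      -- between consecutive coefficients of `C`.
      at-zero : ∀ n {a} → a ℕ.< R → ∀ k → F (suc n) a 0 k ℤ.+ (z· F n a 0) k ≡ C n a 0 k ℤ.- (z· C n a 0) k
      at-zero n {a} a<R zero    = ≡.cong (λ x → ℤ.+ x ℤ.+ 0ℤ) (Φ-below R n (unshifted a<R) ℕ.z≤n)
      at-zero n {a} a<R (suc k) = begin
        F (suc n) a 0 (suc k) ℤ.+ F n a 0 k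
          ≡⟨ ≡.cong₂ (λ x y → ℤ.+ Φ R (suc n) (suc (suc n) ℕ.* x ℕ.+ 0) ℤ.+ ℤ.+ Φ R n y) (shifted a k) (ℕ.+-identityʳ A) ⟩
        ℤ.+ f ℤ.+ ℤ.+ Φ R n A
          ≡⟨ ℤ-difference {f ℕ.+ Φ R n A} {∑< A (Φ R n)}
               (≡.trans (moved f (Φ R n A) (∑< A (Φ R n))) (Φ-zero R n (a ℕ.+ R ℕ.* k))) ⟩
        ℤ.+ ∑< (suc n ℕ.* (a ℕ.+ R ℕ.* k ℕ.+ R) ℕ.+ 0) (Φ R n) ℤ.- ℤ.+ ∑< A (Φ R n)
          ≡⟨ ≡.cong₂ (λ x y → ℤ.+ ∑< (suc n ℕ.* x ℕ.+ 0) (Φ R n) ℤ.- ℤ.+ ∑< y (Φ R n)) (shifted a k) (ℕ.+-identityʳ A) ⟨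
        C n a 0 (suc k) ℤ.- C n a 0 k ∎
        where
        open ≡.≡-Reasoning
        A = suc n ℕ.* (a ℕ.+ R ℕ.* k)
        f = Φ R (suc n) (suc (suc n) ℕ.* (a ℕ.+ R ℕ.* k ℕ.+ R) ℕ.+ 0)
        moved : ∀ x y z → x ℕ.+ y ℕ.+ z ≡ x ℕ.+ (z ℕ.+ y)
        moved = ℕ-Solver.solve-∀
      at-suc : ∀ n {a} i → a ℕ.< R → i ℕ.≤ n → ∀ k → F (suc n) a (suc i) k ≡ C n a (suc i) k ℤ.- (z· C n a (suc i)) k
      at-suc n {a} i a<R i≤n zero    = ≡.trans (≡.cong ℤ.+_ (Φ-below R n (unshifted a<R) (ℕ.s≤s i≤n))) (≡.sym (ℤ.+-identityʳ _))
      at-suc n {a} i a<R i≤n (suc k) = begin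
        F (suc n) a (suc i) (suc k)
          ≡⟨ ≡.cong (λ x → ℤ.+ Φ R (suc n) (suc (suc n) ℕ.* x ℕ.+ suc i)) (shifted a k) ⟩
        ℤ.+ Φ R (suc n) (suc (suc n) ℕ.* (a ℕ.+ R ℕ.* k ℕ.+ R) ℕ.+ suc i)
          ≡⟨ ℤ-difference {Φ R (suc n) (suc (suc n) ℕ.* (a ℕ.+ R ℕ.* k ℕ.+ R) ℕ.+ suc i)}
               {∑< (suc n ℕ.* (a ℕ.+ R ℕ.* k) ℕ.+ suc i) (Φ R n)} (Φ-suc R n (a ℕ.+ R ℕ.* k) i≤n) ⟩
        ℤ.+ ∑< (suc n ℕ.* (a ℕ.+ R ℕ.* k ℕ.+ R) ℕ.+ suc i) (Φ R n) ℤ.- C n a (suc i) k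
          ≡⟨ ≡.cong (λ x → ℤ.+ ∑< (suc n ℕ.* x ℕ.+ suc i) (Φ R n) ℤ.- C n a (suc i) k) (shifted a k) ⟨
        C n a (suc i) (suc k) ℤ.- C n a (suc i) k ∎
        where open ≡.≡-Reasoning

    -- The case `a = 0`, `i = 0` of the recurrence: `α 0` is the diagonal entry of the derangement
    -- matrix.
    derangementPoly≗Φ : ∀ n k → derangementPoly n R k ≡ ℤ.+ Φ R n (suc n ℕ.* (R ℕ.* k))
    derangementPoly≗Φ n k = ≡.trans (gf-∑ˡ exc (filter derangement? (coloredPermutations n R)) k)
      (≡.trans (∑ˡ-derangements indeterminate r n k)
      (≡.trans (≡.sym (Recurrence.F-permanent commutativeRing
          (derangementParameters commutativeRing indeterminate r (λ {p} {q} → 1-z-cancel {p} {q}))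
          satisfies n ℕ.z<s k))
        (≡.cong (λ x → ℤ.+ Φ R n x) (ℕ.+-identityʳ (suc n ℕ.* (R ℕ.* k))))))

-- The lecture hall simplex and the lattice points of its open parallelepiped.

module Simplices where

  open import Data.Rational.Base as ℚ using (ℚ; 0ℚ; 1ℚ; _/_; _+_; _*_; -_; _-_; _≤_; _<_; mkℚ; *<*)
  open import Data.Rational.Properties as ℚ
  open import Algebra.Properties.AbelianGroup +-0-abelianGroup using (xyx⁻¹≈y)
  open import Algebra.Properties.CommutativeMonoid.Sum +-0-commutativeMonoid using (sum; sum-cong-≗)
  open ≡

  s+[p-s]≡p : ∀ s p → s + (p - s) ≡ p
  s+[p-s]≡p s p = trans (sym (+-assoc s p (- s))) (xyx⁻¹≈y s p)

  p≤q⇒0≤q-p : ∀ {p q} → p ≤ q → 0ℚ ≤ q - p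
  p≤q⇒0≤q-p {p} {q} p≤q = subst (_≤ q - p) (+-inverseʳ p) (+-monoˡ-≤ (- p) p≤q)

  ⟦_⟧ : ℤ → ℚ
  ⟦ i ⟧ = i / 1

  private
    lowest : ∀ i → ⟦ i ⟧ ≡ mkℚ i 0 (Coprimality.sym (Coprimality.1-coprimeTo ℤ.∣ i ∣))
    lowest i = ↥p/↧p≡p (mkℚ i 0 _)

  ⟦⟧-+ : ∀ i j → ⟦ i ℤ.+ j ⟧ ≡ ⟦ i ⟧ + ⟦ j ⟧
  ⟦⟧-+ i j rewrite lowest i | lowest j = cong ⟦_⟧ (sym (cong₂ ℤ._+_ (ℤ.*-identityʳ i) (ℤ.*-identityʳ j)))

  ⟦⟧-* : ∀ i j → ⟦ i ℤ.* j ⟧ ≡ ⟦ i ⟧ * ⟦ j ⟧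
  ⟦⟧-* i j rewrite lowest i | lowest j = refl

  ⟦⟧-mono-< : ∀ {i j} → i ℤ.< j → ⟦ i ⟧ < ⟦ j ⟧
  ⟦⟧-mono-< {i} {j} i<j rewrite lowest i | lowest j = *<* (ℤ.*-monoʳ-<-pos 1ℤ i<j)

  ⟦⟧-cancel-< : ∀ {i j} → ⟦ i ⟧ < ⟦ j ⟧ → i ℤ.< j
  ⟦⟧-cancel-< {i} {j} lt rewrite lowest i | lowest j = subst₂ ℤ._<_ (ℤ.*-identityʳ i) (ℤ.*-identityʳ j) (drop-*<* lt)

  ⟦⟧-positive : ∀ n → .{{NonZero n}} → ℚ.Positive ⟦ ℤ.+ n ⟧
  ⟦⟧-positive n = normalize-pos n 1

  ⟦⟧-inverse : ∀ n .{{_ : NonZero n}} → (ℤ.+ 1 / n) * ⟦ ℤ.+ n ⟧ ≡ 1ℚ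
  ⟦⟧-inverse n@(suc k) = toℚᵘ-injective (begin
    ℚ.toℚᵘ ((ℤ.+ 1 / n) * ⟦ ℤ.+ n ⟧)
      ≈⟨ toℚᵘ-homo-* (ℤ.+ 1 / n) ⟦ ℤ.+ n ⟧ ⟩
    ℚ.toℚᵘ (ℤ.+ 1 / n) ℚᵘ.* ℚ.toℚᵘ ⟦ ℤ.+ n ⟧
      ≈⟨ ℚᵘ.*-cong (toℚᵘ-fromℚᵘ (ℚᵘ.mkℚᵘ (ℤ.+ 1) k)) (toℚᵘ-fromℚᵘ (ℚᵘ.mkℚᵘ (ℤ.+ n) 0)) ⟩
    ℚᵘ.mkℚᵘ (ℤ.+ 1) k ℚᵘ.* ℚᵘ.mkℚᵘ (ℤ.+ n) 0
      ≈⟨ ℚᵘ.*≡* (trans (ℤ.*-identityʳ (ℤ.+ 1 ℤ.* ℤ.+ n)) (trans (ℤ.*-identityˡ (ℤ.+ n))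
           (sym (trans (ℤ.*-identityˡ _) (cong ℤ.+_ (ℕ.*-identityʳ n)))))) ⟩
    ℚᵘ.1ℚᵘ ∎)
    where open ℚᵘ.≃-Reasoning

  module _ (T : ℕ) .{{_ : NonZero T}} where

    *⟦⟧-/ : ∀ p → p * ⟦ ℤ.+ T ⟧ * (ℤ.+ 1 / T) ≡ p
    *⟦⟧-/ p = trans (*-assoc p _ _) (trans (cong (p *_) (trans (*-comm ⟦ ℤ.+ T ⟧ _) (⟦⟧-inverse T))) (*-identityʳ p))

    /-*⟦⟧ : ∀ p → p * (ℤ.+ 1 / T) * ⟦ ℤ.+ T ⟧ ≡ p
    /-*⟦⟧ p = trans (*-assoc p _ _) (trans (cong (p *_) (⟦⟧-inverse T)) (*-identityʳ p))

  -- Decides i ≤ j; the i-th vertex will be (0, …, 0, tᵢ₊₁, …, tₘ).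
  upper : ∀ {n m} → Fin n → Fin m → Bool
  upper zero    j       = true
  upper (suc i) zero    = false
  upper (suc i) (suc j) = upper i j

  -- The partial sum c₀ + ⋯ + cₖ, constant from k = n - 1 on.
  psum : ∀ {n} → (Fin n → ℚ) → ℕ → ℚ
  psum {zero}  c k       = 0ℚ
  psum {suc n} c zero    = c zero
  psum {suc n} c (suc k) = c zero + psum (c ∘ suc) k

  psum-sum : ∀ {n} (c : Fin (suc n) → ℚ) → psum c n ≡ sum c
  psum-sum {zero}  c = sym (+-identityʳ (c zero))
  psum-sum {suc n} c = cong (c zero +_) (psum-sum (c ∘ suc))

  psum-zero : ∀ {n} (c : Fin n → ℚ) → (∀ k → k ℕ.< n → psum c k ≡ 0ℚ) → ∀ i → c i ≡ 0ℚ
  psum-zero c z zero    = z 0 ℕ.z<s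
  psum-zero c z (suc i) = psum-zero (c ∘ suc) (λ k k<n →
    trans (sym (+-identityˡ _)) (trans (cong (_+ psum (c ∘ suc) k) (sym (z 0 ℕ.z<s))) (z (suc k) (ℕ.s<s k<n)))) i

  psum-nonNeg : ∀ {n} (c : Fin n → ℚ) → (∀ i → 0ℚ ≤ c i) → ∀ k → 0ℚ ≤ psum c k
  psum-nonNeg {zero}  c c≥0 k       = ≤-refl
  psum-nonNeg {suc n} c c≥0 zero    = c≥0 zero
  psum-nonNeg {suc n} c c≥0 (suc k) = +-mono-≤ (c≥0 zero) (psum-nonNeg (c ∘ suc) (c≥0 ∘ suc) k)

  psum-mono : ∀ {n} (c : Fin n → ℚ) → (∀ i → 0ℚ ≤ c i) → ∀ {k l} → k ℕ.≤ l → psum c k ≤ psum c l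
  psum-mono {zero}  c c≥0 _ = ≤-refl
  psum-mono {suc n} c c≥0 {zero}  {zero}  _   = ≤-refl
  psum-mono {suc n} c c≥0 {zero}  {suc l} _   =
    ≤-trans (≤-reflexive (sym (+-identityʳ (c zero)))) (+-monoʳ-≤ (c zero) (psum-nonNeg (c ∘ suc) (c≥0 ∘ suc) l))
  psum-mono {suc n} c c≥0 {suc k} {suc l} k≤l = +-monoʳ-≤ (c zero) (psum-mono (c ∘ suc) (c≥0 ∘ suc) (ℕ.s≤s⁻¹ k≤l))

  sum-*-zero : ∀ {n} (c : Fin n → ℚ) → sum (λ i → c i * ⟦ 0ℤ ⟧) ≡ 0ℚ
  sum-*-zero {zero}  c = refl
  sum-*-zero {suc n} c = cong₂ _+_ (*-zeroʳ (c zero)) (sum-*-zero (c ∘ suc))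

  sum-upper : ∀ {n m} (c : Fin n → ℚ) (j : Fin m) (T : ℤ) →
              sum (λ i → c i * ⟦ if upper i j then T else 0ℤ ⟧) ≡ psum c (toℕ j) * ⟦ T ⟧
  sum-upper {zero}  c j       T = sym (*-zeroˡ ⟦ T ⟧)
  sum-upper {suc n} c zero    T = trans (cong (c zero * ⟦ T ⟧ +_) (sum-*-zero (c ∘ suc))) (+-identityʳ _)
  sum-upper {suc n} c (suc j) T = trans (cong (c zero * ⟦ T ⟧ +_) (sum-upper (c ∘ suc) j T))
    (sym (*-distribʳ-+ ⟦ T ⟧ (c zero) _))

  combination-upper : ∀ {n m} (c : Fin n → ℚ) (v : Fin n → Vec ℤ m) (T : Fin m → ℤ) →
    (∀ i j → lookup (v i) j ≡ (if upper i j then T j else 0ℤ)) →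
    ∀ j → combination c v j ≡ psum c (toℕ j) * ⟦ T j ⟧
  combination-upper c v T e j = trans
    (sum-cong-≗ (λ i → cong (λ w → c i * ⟦ w ⟧) (e i j)))
    (sum-upper c j (T j))

  -- Here `s = x / t` and `s + γ = w / t′`, so `γ` times `t t′` is `w t - x t′`. The bounds
  -- `0 < γ < 1` are therefore inequalities between integers, namely those of `Step`.
  module Gap (t t′ x : ℕ) (w : ℤ) (s γ : ℚ) .{{_ : NonZero t}} .{{_ : NonZero t′}}
             (s-value : s * ⟦ ℤ.+ t ⟧ ≡ ⟦ ℤ.+ x ⟧) (γ-value : (s + γ) * ⟦ ℤ.+ t′ ⟧ ≡ ⟦ w ⟧) where

    private
      area = ⟦ ℤ.+ t ⟧ * ⟦ ℤ.+ t′ ⟧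
      low  = ℤ.+ x ℤ.* ℤ.+ t′
      mid  = w ℤ.* ℤ.+ t
      high = low ℤ.+ ℤ.+ t ℤ.* ℤ.+ t′

      instance
        area-positive : ℚ.Positive area
        area-positive = pos*pos⇒pos ⟦ ℤ.+ t ⟧ {{⟦⟧-positive t}} ⟦ ℤ.+ t′ ⟧ {{⟦⟧-positive t′}}
        area-nonNeg : ℚ.NonNegative area
        area-nonNeg = pos⇒nonNeg area

      mid-value : ⟦ low ⟧ + γ * area ≡ ⟦ mid ⟧
      mid-value = begin
        ⟦ low ⟧ + γ * area                      ≡⟨ cong (_+ γ * area) (trans (⟦⟧-* (ℤ.+ x) (ℤ.+ t′)) (cong (_* ⟦ ℤ.+ t′ ⟧) (sym s-value))) ⟩
        s * ⟦ ℤ.+ t ⟧ * ⟦ ℤ.+ t′ ⟧ + γ * area   ≡⟨ expand s γ ⟦ ℤ.+ t ⟧ ⟦ ℤ.+ t′ ⟧ ⟩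
        (s + γ) * ⟦ ℤ.+ t′ ⟧ * ⟦ ℤ.+ t ⟧        ≡⟨ cong (_* ⟦ ℤ.+ t ⟧) γ-value ⟩
        ⟦ w ⟧ * ⟦ ℤ.+ t ⟧                       ≡⟨ ⟦⟧-* w (ℤ.+ t) ⟨
        ⟦ mid ⟧                                 ∎
        where
        open ≡-Reasoning
        expand : ∀ s γ a b → s * a * b + γ * (a * b) ≡ (s + γ) * b * a
        expand s γ a b = begin
          s * a * b + γ * (a * b)     ≡⟨ cong (_+ γ * (a * b)) (*-assoc s a b) ⟩
          s * (a * b) + γ * (a * b)   ≡⟨ *-distribʳ-+ (a * b) s γ ⟨
          (s + γ) * (a * b)           ≡⟨ cong ((s + γ) *_) (*-comm a b) ⟩
          (s + γ) * (b * a)           ≡⟨ *-assoc (s + γ) b a ⟨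
          (s + γ) * b * a             ∎

      low-value : ⟦ low ⟧ + 0ℚ * area ≡ ⟦ low ⟧
      low-value = trans (cong (⟦ low ⟧ +_) (*-zeroˡ area)) (+-identityʳ _)

      high-value : ⟦ low ⟧ + 1ℚ * area ≡ ⟦ high ⟧
      high-value = trans (cong (⟦ low ⟧ +_) (trans (*-identityˡ area) (sym (⟦⟧-* (ℤ.+ t) (ℤ.+ t′))))) (sym (⟦⟧-+ low _))

      affine-mono : ∀ {p q} → p < q → ⟦ low ⟧ + p * area < ⟦ low ⟧ + q * area
      affine-mono p<q = +-monoʳ-< ⟦ low ⟧ (*-monoˡ-<-pos area p<q)

      affine-cancel : ∀ {p q} → ⟦ low ⟧ + p * area < ⟦ low ⟧ + q * area → p < q
      affine-cancel {p} {q} lt = *-cancelʳ-<-nonNeg area (subst₂ _<_ (dropped (p * area)) (dropped (q * area)) (+-monoʳ-< (- ⟦ low ⟧) lt))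
        where
        dropped : ∀ y → - ⟦ low ⟧ + (⟦ low ⟧ + y) ≡ y
        dropped y = trans (sym (+-assoc (- ⟦ low ⟧) ⟦ low ⟧ y)) (trans (cong (_+ y) (+-inverseˡ ⟦ low ⟧)) (+-identityˡ y))

    gap-inside⁻ : 0ℚ < γ × γ < 1ℚ → low ℤ.< mid × mid ℤ.< high
    gap-inside⁻ (0<γ , γ<1) =
        ⟦⟧-cancel-< (subst₂ _<_ low-value mid-value (affine-mono 0<γ))
      , ⟦⟧-cancel-< (subst₂ _<_ mid-value high-value (affine-mono γ<1))

    gap-inside⁺ : low ℤ.< mid × mid ℤ.< high → 0ℚ < γ × γ < 1ℚ
    gap-inside⁺ (low<mid , mid<high) =
        affine-cancel (subst₂ _<_ (sym low-value) (sym mid-value) (⟦⟧-mono-< low<mid))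
      , affine-cancel (subst₂ _<_ (sym mid-value) (sym high-value) (⟦⟧-mono-< mid<high))

  -- Coordinates of a lattice point are arbitrary integers at first; the lower half of a step shows
  -- in turn that each is a natural number.
  positive-entry : ∀ {w : ℤ} {a t} .{{_ : NonZero t}} → ℤ.+ a ℤ.< w ℤ.* ℤ.+ t → ∃[ x ] w ≡ ℤ.+ x
  positive-entry {ℤ.+ x}      {a} {suc t} lt = x , refl
  positive-entry { ℤ.-[1+ n ]} {a} {suc t} ()

  Step⇔ : ∀ t t′ x x′ → Step t x t′ x′ ⇔
    (ℤ.+ x ℤ.* ℤ.+ t′ ℤ.< ℤ.+ x′ ℤ.* ℤ.+ t × ℤ.+ x′ ℤ.* ℤ.+ t ℤ.< ℤ.+ x ℤ.* ℤ.+ t′ ℤ.+ ℤ.+ t ℤ.* ℤ.+ t′)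
  Step⇔ t t′ x x′
    rewrite sym (ℤ.pos-* x t′) | sym (ℤ.pos-* x′ t) | sym (ℤ.pos-* t t′) | ℕ.*-distribʳ-+ t′ x t = mk⇔
    (λ (p , q) → ℤ.+<+ p , ℤ.+<+ q)
    (λ (p , q) → ℤ.drop‿+<+ p , ℤ.drop‿+<+ q)

  -- Membership in the open parallelepiped in triangular form: the coefficients are the gaps between
  -- consecutive ratios. The offset `s` is the ratio reached so far, so that the notion passes to
  -- tails.
  Gaps : ∀ {n} (t : ℕ → ℕ) (s : ℚ) (w : Vec ℤ n) → Set
  Gaps {n} t s w = ∃[ c ] (∀ (i : Fin n) → 0ℚ < c i × c i < 1ℚ) ×
                          (∀ j → (s + psum c (toℕ j)) * ⟦ ℤ.+ t (suc (toℕ j)) ⟧ ≡ ⟦ lookup w j ⟧)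

  gaps⇒chain : ∀ {n} t → (∀ i → NonZero (t i)) → ∀ x s → s * ⟦ ℤ.+ t 0 ⟧ ≡ ⟦ ℤ.+ x ⟧ →
               (w : Vec ℤ n) → Gaps t s w → ∃[ h ] Chain t x w h
  gaps⇒chain t nz x s e []      _ = x , []
  gaps⇒chain t nz x s e (w ∷ ws) (c , inside , values) =
    continue (positive-entry {w} {x ℕ.* t 1} {t 0} (subst (ℤ._< w ℤ.* ℤ.+ t 0) (sym (ℤ.pos-* x (t 1))) (proj₁ between)))
    where
    instance
      _ = nz 0
      _ = nz 1
    open Gap (t 0) (t 1) x w s (c zero) e (values zero)
    between = gap-inside⁻ (inside zero)
    rest : Gaps (t ∘ suc) (s + c zero) ws
    rest = c ∘ suc , inside ∘ suc , λ j →
      trans (cong (_* ⟦ ℤ.+ t (suc (suc (toℕ j))) ⟧) (+-assoc s (c zero) (psum (c ∘ suc) (toℕ j)))) (values (suc j))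
    continue : ∃[ x′ ] w ≡ ℤ.+ x′ → ∃[ h ] Chain t x (w ∷ ws) h
    continue (x′ , w≡x′) =
        proj₁ tail
      , subst (λ w → Chain t x (w ∷ ws) (proj₁ tail)) (sym w≡x′)
          (Equivalence.from (Step⇔ (t 0) (t 1) x x′)
            (subst (λ w → ℤ.+ x ℤ.* ℤ.+ t 1 ℤ.< w ℤ.* ℤ.+ t 0 × w ℤ.* ℤ.+ t 0 ℤ.< ℤ.+ x ℤ.* ℤ.+ t 1 ℤ.+ ℤ.+ t 0 ℤ.* ℤ.+ t 1) w≡x′ between)
            ∷ proj₂ tail)
      where
      tail : ∃[ h ] Chain (t ∘ suc) x′ ws h
      tail = gaps⇒chain (t ∘ suc) (nz ∘ suc) x′ (s + c zero) (trans (values zero) (cong ⟦_⟧ w≡x′)) ws rest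

  chain⇒gaps : ∀ {n} t → (∀ i → NonZero (t i)) → ∀ {x h} s → s * ⟦ ℤ.+ t 0 ⟧ ≡ ⟦ ℤ.+ x ⟧ →
               {w : Vec ℤ n} → Chain t x w h → Gaps t s w
  chain⇒gaps t nz s e [] = (λ ()) , (λ ()) , λ ()
  chain⇒gaps {suc n} t nz {x} s e {_ ∷ ws} (_∷_ {x′ = x′} step chain) =
    extend (chain⇒gaps (t ∘ suc) (nz ∘ suc) (s + γ) value chain)
    where
    instance
      _ = nz 0
      _ = nz 1
    γ = ⟦ ℤ.+ x′ ⟧ * (ℤ.+ 1 / t 1) - s
    value : (s + γ) * ⟦ ℤ.+ t 1 ⟧ ≡ ⟦ ℤ.+ x′ ⟧
    value = trans (cong (_* ⟦ ℤ.+ t 1 ⟧) (s+[p-s]≡p s (⟦ ℤ.+ x′ ⟧ * (ℤ.+ 1 / t 1)))) (/-*⟦⟧ (t 1) ⟦ ℤ.+ x′ ⟧)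
    open Gap (t 0) (t 1) x (ℤ.+ x′) s γ e value
    extend : Gaps (t ∘ suc) (s + γ) ws → Gaps t s (ℤ.+ x′ ∷ ws)
    extend (c , inside , values) =
        (λ { zero → γ ; (suc i) → c i })
      , (λ { zero → gap-inside⁺ (Equivalence.to (Step⇔ (t 0) (t 1) x x′) step) ; (suc i) → inside i })
      , (λ { zero → value ; (suc j) → trans (cong (_* ⟦ ℤ.+ t (suc (suc (toℕ j))) ⟧) (sym (+-assoc s γ _))) (values j) })

  -- The barycentric coordinates are the successive differences of the ratios, bordered by 0 and 1.
  -- The lower border is generalised to `s` for the induction.
  increments : ∀ {m} (y : Fin m → ℚ) s top → (∀ i → s ≤ y i) → (∀ i j → i Fin.≤ j → y i ≤ y j) →
    (∀ i → y i ≤ top) → s ≤ top →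
    ∃[ c ] (∀ (i : Fin (suc m)) → 0ℚ ≤ c i) × s + sum c ≡ top × (∀ j → s + psum c (toℕ j) ≡ y j)
  increments {zero} y s top _ _ _ s≤top =
    (λ _ → top - s) , (λ _ → p≤q⇒0≤q-p s≤top) , trans (cong (s +_) (+-identityʳ _)) (s+[p-s]≡p s top) , λ ()
  increments {suc m} y s top s≤y mono y≤top _
    with c , c≥0 , total , values ← increments (y ∘ suc) (y zero) top (λ i → mono zero (suc i) ℕ.z≤n)
      (λ i j i≤j → mono (suc i) (suc j) (ℕ.s≤s i≤j)) (y≤top ∘ suc) (y≤top zero) =
      (λ { zero → y zero - s ; (suc i) → c i })
    , (λ { zero → p≤q⇒0≤q-p (s≤y zero) ; (suc i) → c≥0 i })
    , trans (regroup _) total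
    , (λ { zero → first ; (suc j) → trans (regroup _) (values j) })
    where
    first : s + (y zero - s) ≡ y zero
    first = s+[p-s]≡p s (y zero)
    regroup : ∀ p → s + (y zero - s + p) ≡ y zero + p
    regroup p = trans (sym (+-assoc s (y zero - s) p)) (cong (_+ p) first)

  -- `t` extends the terms of `T` at both ends: `t 0` goes with `x₀ = 0`, and `t (suc m)` sets the
  -- scale on which the height is counted.
  module LectureHall (t : ℕ → ℕ) (t≢0 : ∀ i → NonZero (t i)) (m : ℕ) (T : PositiveSeq m)
                     (T-term : ∀ i → PositiveSeq.term T i ≡ t (suc (toℕ i))) where

    private instance
      nonZero : ∀ {i} → NonZero (t i)
      nonZero {i} = t≢0 i

    vertex : Fin (suc m) → Vec ℤ m
    vertex i = Vec.tabulate λ j → if upper i j then ℤ.+ t (suc (toℕ j)) else 0ℤ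

    combination-vertex : ∀ (c : Fin (suc m) → ℚ) j →
      combination c vertex j ≡ psum c (toℕ j) * ⟦ ℤ.+ t (suc (toℕ j)) ⟧
    combination-vertex c = combination-upper c vertex _ (λ i → Vec.lookup∘tabulate _)

    ratio≡ : ∀ (p : ℚ) i → p * (_/_ (ℤ.+ 1) (PositiveSeq.term T i) {{PositiveSeq.nonZero T i}}) ≡ p * (ℤ.+ 1 / t (suc (toℕ i)))
    ratio≡ p i = cong (p *_) (/-cong {ℤ.+ 1} {_} {ℤ.+ 1} {{PositiveSeq.nonZero T i}} refl (T-term i))

    -- Each coordinate of a combination is a partial sum of coefficients times a positive term, and
    -- the last partial sum is the total. So all partial sums vanish, hence all coefficients.
    independent : AffinelyIndependent vertex
    independent c total combination≡0 = psum-zero c zero-psum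
      where
      zero-psum : ∀ k → k ℕ.< suc m → psum c k ≡ 0ℚ
      zero-psum k k≤m with ℕ.m≤n⇒m<n∨m≡n (ℕ.s≤s⁻¹ k≤m)
      ... | inj₂ refl = trans (psum-sum c) total
      ... | inj₁ k<m  = begin
        psum c k                                  ≡⟨ *⟦⟧-/ (t (suc k)) (psum c k) ⟨
        psum c k * ⟦ ℤ.+ t (suc k) ⟧ * (ℤ.+ 1 / t (suc k))
          ≡⟨ cong (_* (ℤ.+ 1 / t (suc k))) vanishing ⟩
        0ℚ * (ℤ.+ 1 / t (suc k))                  ≡⟨ *-zeroˡ (ℤ.+ 1 / t (suc k)) ⟩
        0ℚ                                        ∎
        where
        open ≡-Reasoning
        vanishing : psum c k * ⟦ ℤ.+ t (suc k) ⟧ ≡ 0ℚ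
        vanishing = subst (λ k → psum c k * ⟦ ℤ.+ t (suc k) ⟧ ≡ 0ℚ) (Fin.toℕ-fromℕ< k<m)
          (trans (sym (combination-vertex c (Fin.fromℕ< k<m))) (combination≡0 (Fin.fromℕ< k<m)))

    hull : lectureHall T ≐ conv vertex
    hull = to , from
      where
      to : ∀ {x} → lectureHall T x → conv vertex x
      to {x} (y≥0 , mono , y≤1)
        with c , c≥0 , total , values ← increments _ 0ℚ 1ℚ y≥0 mono y≤1 (nonNegative⁻¹ 1ℚ) =
        c , c≥0 , trans (sym (+-identityˡ (sum c))) total , λ j → begin
          combination c vertex j
            ≡⟨ combination-vertex c j ⟩
          psum c (toℕ j) * ⟦ ℤ.+ t (suc (toℕ j)) ⟧
            ≡⟨ cong (_* ⟦ ℤ.+ t (suc (toℕ j)) ⟧) (trans (sym (+-identityˡ (psum c (toℕ j)))) (trans (values j) (ratio≡ (x j) j))) ⟩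
          x j * (ℤ.+ 1 / t (suc (toℕ j))) * ⟦ ℤ.+ t (suc (toℕ j)) ⟧
            ≡⟨ /-*⟦⟧ (t (suc (toℕ j))) (x j) ⟩
          x j ∎
        where open ≡-Reasoning
      from : ∀ {x} → conv vertex x → lectureHall T x
      from {x} (c , c≥0 , total , x≡) =
          (λ i → subst (0ℚ ≤_) (sym (value i)) (psum-nonNeg c c≥0 (toℕ i)))
        , (λ i j i≤j → subst₂ _≤_ (sym (value i)) (sym (value j)) (psum-mono c c≥0 i≤j))
        , (λ i → subst₂ _≤_ (sym (value i)) (trans (psum-sum c) total) (psum-mono c c≥0 (ℕ.<⇒≤ (Fin.toℕ<n i))))
        where
        value : ∀ i → x i * (_/_ (ℤ.+ 1) (PositiveSeq.term T i) {{PositiveSeq.nonZero T i}}) ≡ psum c (toℕ i)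
        value i = trans (ratio≡ (x i) i) (trans
          (cong (_* (ℤ.+ 1 / t (suc (toℕ i)))) (trans (sym (x≡ i)) (combination-vertex c i)))
          (*⟦⟧-/ (t (suc (toℕ i))) (psum c (toℕ i))))

    -- Appending the height 1 to every vertex keeps the triangular shape, with 1 as the term of the
    -- new last coordinate.
    lookup-snoc : ∀ n (t : ℕ → ℕ) (i j : Fin (suc n)) →
      lookup (Vec.tabulate {n = n} (λ j → if upper i j then ℤ.+ t (suc (toℕ j)) else 0ℤ) ∷ʳ 1ℤ) j ≡
      (if upper i j then ℤ.+ cap n t (suc (toℕ j)) else 0ℤ)
    lookup-snoc zero    t zero    zero    = refl
    lookup-snoc (suc n) t zero    zero    = cong ℤ.+_ (sym (cap-≤ n (t ∘ suc) ℕ.z≤n))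
    lookup-snoc (suc n) t (suc i) zero    = refl
    lookup-snoc (suc n) t zero    (suc j) = lookup-snoc n (t ∘ suc) zero j
    lookup-snoc (suc n) t (suc i) (suc j) = lookup-snoc n (t ∘ suc) i j

    private
      t′ = cap m t

      combination-snoc : ∀ (c : Fin (suc m) → ℚ) j →
        combination c (λ i → vertex i ∷ʳ 1ℤ) j ≡ (0ℚ + psum c (toℕ j)) * ⟦ ℤ.+ t′ (suc (toℕ j)) ⟧
      combination-snoc c j = trans
        (combination-upper c (λ i → vertex i ∷ʳ 1ℤ) (λ j → ℤ.+ t′ (suc (toℕ j))) (lookup-snoc m t) j)
        (cong (_* ⟦ ℤ.+ t′ (suc (toℕ j)) ⟧) (sym (+-identityˡ (psum c (toℕ j)))))

      chain⇔Π° : ∀ w → (∃[ h ] Chain t′ 0 w h) ⇔ Π° vertex (ι w)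
      chain⇔Π° w = mk⇔
        (λ (h , chain) → let c , inside , values = chain⇒gaps t′ (cap-nonZero m t t≢0) 0ℚ origin chain in
          c , inside , λ j → trans (combination-snoc c j) (values j))
        (λ (c , inside , values) → gaps⇒chain t′ (cap-nonZero m t t≢0) 0 0ℚ origin w
          (c , inside , λ j → trans (sym (combination-snoc c j)) (values j)))
        where
        origin : 0ℚ * ⟦ ℤ.+ t′ 0 ⟧ ≡ 0ℚ
        origin = *-zeroˡ ⟦ ℤ.+ t′ 0 ⟧

    isℓ* : IsLectureHallℓ* T (λ k → ℤ.+ count t (suc m) (t (suc m) ℕ.* k))
    isℓ* = record
      { dim         = m
      ; vertices    = vertex
      ; independent = independent
      ; hull        = hull
      ; isGF        = record
        { elements = lattice-points t′ m
        ; distinct = lattice-points-unique t′ m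
        ; complete = λ w → mk⇔
            (λ w∈ → Equivalence.to (chain⇔Π° w) (Equivalence.to (∈-lattice-points t′ m w) w∈))
            (λ w∈Π° → Equivalence.from (∈-lattice-points t′ m w) (Equivalence.from (chain⇔Π° w) w∈Π°))
        ; coeffs   = λ k → sym (trans (gf-lattice-points t′ m k) (cong ℤ.+_ (count-cap m t k)))
        }
      }


open DerangementSeries
open Simplices
open ≡

-- Uniqueness of the decomposition, and the assembly.

splits-unique : ∀ {d p a b a′ b′} → Splits d p a b → Splits d p a′ b′ → (a′ ≗ a) × (b′ ≗ b)
splits-unique {d} {p} {a} {b} {a′} {b′} S S′ = a′≗a , b′≗b
  where
  module S  = Splits S
  module S′ = Splits S′
  open import Data.Nat.Base using (_∸_)
  open import Algebra.Properties.AbelianGroup ℤ.+-0-abelianGroup using (∙-cancelˡ; ∙-cancelʳ)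

  same : ∀ k → a′ k ℤ.+ (z· b′) k ≡ a k ℤ.+ (z· b) k
  same k = trans (sym (S′.sum-≡ k)) (S.sum-≡ k)

  b-from-a : ∀ k → a′ (suc k) ≡ a (suc k) → b′ k ≡ b k
  b-from-a k e = ∙-cancelˡ (a (suc k)) (b′ k) (b k) (trans (cong (ℤ._+ b′ k) (sym e)) (same (suc k)))

  a-from-b : ∀ k → b′ k ≡ b k → a′ (suc k) ≡ a (suc k)
  a-from-b k e = ∙-cancelʳ (b k) (a′ (suc k)) (a (suc k)) (trans (cong (λ w → a′ (suc k) ℤ.+ w) (sym e)) (same (suc k)))

  -- Palindromicity turns agreement of a at k into agreement at d - k, hence of b at
  -- d - k - 1, hence of b at k, hence of a at k + 1.
  a′≗a : a′ ≗ a
  a′≗a zero    = ∙-cancelʳ 0ℤ (a′ 0) (a 0) (same 0)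
  a′≗a (suc k) with k ℕ.<? d
  ... | no k≮d  = trans (S′.deg-a (suc k) (ℕ.s≤s (ℕ.≮⇒≥ k≮d))) (sym (S.deg-a (suc k) (ℕ.s≤s (ℕ.≮⇒≥ k≮d))))
  ... | yes k<d = a-from-b k (begin
    b′ k              ≡⟨ S′.pal-b k l k+l ⟩
    b′ l              ≡⟨ b-from-a l (begin
      a′ (suc l)        ≡⟨ S′.pal-a (suc l) k l+k ⟩
      a′ k              ≡⟨ a′≗a k ⟩
      a k               ≡⟨ S.pal-a (suc l) k l+k ⟨
      a (suc l)         ∎) ⟩
    b l               ≡⟨ S.pal-b k l k+l ⟨
    b k               ∎)
    where
    open ≡-Reasoning
    l = d ∸ suc k
    k+l : suc (k ℕ.+ l) ≡ d
    k+l = ℕ.m+[n∸m]≡n k<d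
    l+k : suc (suc l ℕ.+ k) ≡ suc d
    l+k = cong suc (trans (cong suc (ℕ.+-comm l k)) k+l)

  b′≗b : b′ ≗ b
  b′≗b k = b-from-a k (a′≗a (suc k))


theorem4p13 : ∀ (n r : ℕ) .{{_ : NonZero n}} .{{_ : NonZero r}} →
    ∃[ dˢ ] ∃[ dᵘ ] ∃[ b ]
    IsLectureHallℓ* (s-seq n r) dˢ ×
    IsLectureHallℓ* (μ-seq n r) dᵘ ×
    (dᵘ ≗ z· b) ×
    IsIDecomposition n (derangementPoly n r) dˢ b
theorem4p13 n@(suc m) r@(suc r′) =
    dˢ , dᵘ , b
  , LectureHall.isℓ* (sᵗ r) sᵗ≢0 m (s-seq n r) (λ _ → refl)
  , LectureHall.isℓ* (μᵗ r) μᵗ≢0 n (μ-seq n r) (λ _ → refl)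
  , dᵘ≗zb
  , record { splits = splits ; unique = λ _ _ → splits-unique splits }
  where
  sᵗ≢0 : ∀ i → NonZero (sᵗ r i)
  sᵗ≢0 i = ℕ.m*n≢0 (suc i) r
  μᵗ≢0 : ∀ i → NonZero (μᵗ r i)
  μᵗ≢0 zero    = _
  μᵗ≢0 (suc i) = sᵗ≢0 i

  -- Both sequences continue with the term `(n + 1) r = sᵗ r n`, so both are evaluated at the same
  -- multiples and add up to `Φ r n`.
  dˢ dᵘ b : Poly
  dˢ k = ℤ.+ count (sᵗ r) n (sᵗ r n ℕ.* k)
  dᵘ k = ℤ.+ count (μᵗ r) (suc n) (sᵗ r n ℕ.* k)
  b k  = dᵘ (suc k)

  count-reflect′ : ∀ t j k l → k ℕ.+ l ≡ j → count t j (t j ℕ.* k) ≡ count t j (t j ℕ.* l)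
  count-reflect′ t j k l e = count-reflect t j (t j ℕ.* k) (t j ℕ.* l)
    (trans (sym (ℕ.*-distribˡ-+ (t j) k l)) (trans (ℕ.*-comm (t j) (k ℕ.+ l)) (cong (ℕ._* t j) e)))

  count-top : ∀ t j {k} → suc j ℕ.≤ k → count t (suc j) (t (suc j) ℕ.* k) ≡ 0
  count-top t j {k} j<k = count-beyond t j (t (suc j) ℕ.* k)
    (ℕ.≤-trans (ℕ.*-monoˡ-≤ (t (suc j)) j<k) (ℕ.≤-reflexive (ℕ.*-comm k (t (suc j)))))

  -- Reflection takes height 0 to height `n + 1`, which no chain reaches. Hence `dᵘ` is divisible by
  -- `z`, with quotient `b`.
  dᵘ-zero : dᵘ 0 ≡ 0ℤ
  dᵘ-zero = cong ℤ.+_ (trans (count-reflect′ (μᵗ r) (suc n) 0 (suc n) refl) (count-top (μᵗ r) n ℕ.≤-refl))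

  dᵘ≗zb : dᵘ ≗ z· b
  dᵘ≗zb zero    = dᵘ-zero
  dᵘ≗zb (suc k) = refl

  splits : Splits n (derangementPoly n r) dˢ b
  splits = record
    { sum-≡ = λ k → begin
        derangementPoly n r k
          ≡⟨ derangementPoly≗Φ r′ n k ⟩
        ℤ.+ Φ r n (suc n ℕ.* (r ℕ.* k))
          ≡⟨ cong (λ x → ℤ.+ Φ r n x) (sym (ℕ.*-assoc (suc n) r k)) ⟩
        dˢ k ℤ.+ dᵘ k
          ≡⟨ cong (λ w → dˢ k ℤ.+ w) (dᵘ≗zb k) ⟩
        dˢ k ℤ.+ (z· b) k ∎
    ; deg-a = λ k n<k → cong ℤ.+_ (count-top (sᵗ r) m (ℕ.<⇒≤ n<k))
    ; deg-b = λ k n≤k → cong ℤ.+_ (count-top (μᵗ r) n (ℕ.s≤s n≤k))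
    ; pal-a = λ i j e → cong ℤ.+_ (count-reflect′ (sᵗ r) n i j (ℕ.suc-injective e))
    -- Reflected exponents of `dᵘ` add up to `n + 1`; dividing by `z` lowers both by one, which
    -- leaves the sum `n - 1` required of `b`.
    ; pal-b = λ i j e → cong ℤ.+_ (count-reflect′ (μᵗ r) (suc n) (suc i) (suc j) (cong suc (trans (ℕ.+-suc i j) e)))
    }
    where open ≡-Reasoning
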